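{- For $\sigma\in S_n(132)$, let $L^{U^3D}_n(\sigma)$ denote the length of the longest subsequence of $\sigma$ that repeats the up/down pattern $UUUD$ (so $L^{U^3D}_n(\sigma)$ is either equal to $0$ or to $4k+1$ for some $k\in\mathbb{N}$). Then $$E_n^{\text{av}(132)}L^{U^3D}_n\sim\frac4{11} n\quad\text{as } n\to\infty.$$
   Context: $S_n$ is the set of permutations $\sigma=\sigma_1\cdots\sigma_n$ of $[n]=\{1,\dots,n\}$. A permutation $\sigma\in S_n$ avoids $\tau\in S_3$ if there are no indices $i_1<i_2<i_3$ such that $\sigma_{i_1}\sigma_{i_2}\sigma_{i_3}$ is in the same relative order as $\tau_1\tau_2\tau_3$; $S_n(\tau)$ is the set of $\sigma\in S_n$ avoiding $\tau$. $P_n^{\text{av}(\tau)}$ is the uniform probability measure on $S_n(\tau)$ and $E_n^{\text{av}(\tau)}$ is the corresponding expectation. To a subsequence $\sigma_{i_1},\dots,\sigma_{i_m}$ ($i_1<\cdots<i_m$, $m\ge 2$) of $\sigma$ associate the up/down sequence $V_1\cdots V_{m-1}$, where $V_j=U$ if $\sigma_{i_{j+1}}>\sigma_{i_j}$ and $V_j=D$ if $\sigma_{i_{j+1}}<\sigma_{i_j}$. For a fixed up/down pattern $W=W_1\cdots W_l$ with $W_j\in\{U,D\}$, a subsequence repeats the pattern $W$ if its up/down sequence is $W$ concatenated with itself $k$ times for some $k\in\mathbb{N}=\{1,2,\dots\}$ (so it has length $kl+1$; incomplete patterns are not counted). The length of the longest subsequence repeating $W$ is the maximum such $kl+1$, and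 is $0$ if no such subsequence exists. The notation $x_n\sim y_n$ means $x_n/y_n\to1$ as $n\to\infty$. -}

module Defs where

open import Data.Bool using (if_then_else_)
open import Data.Fin as Fin using (Fin)
open import Data.Fin.Patterns using (0F; 1F; 2F)
import Data.Fin.Properties as Fin
open import Data.Integer using (+_)
open import Data.List as List
  using (List; []; _∷_; [_]; _++_; map; filter; concat; replicate; length; allFin; cartesianProductWith)
open import Data.List.Extrema.Nat using (max)
open import Data.List.NonEmpty as List⁺ using (List⁺; _∷_)
import Data.List.Properties as List
open import Data.Nat as ℕ using (ℕ; zero; suc; s≤s; z≤n)
open import Data.Nat.ListAction using (sum)
import Data.Nat.Properties as ℕ
open import Data.Product using (Σ-syntax; ∃-syntax; _×_; _,_)
open import Data.Rational as ℚ using (ℚ; 0ℚ; 1ℚ; _÷_; ∣_∣)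
open import Data.Vec as Vec using (Vec; []; _∷_; lookup)
open import Data.Vec.Relation.Unary.AllPairs using (allPairs?)
open import Data.Vec.Relation.Unary.Unique.Propositional using (Unique)
open import Function using (_⇔_; mk⇔; Equivalence)
open import Relation.Binary.Definitions using (DecidableEquality)
open import Relation.Binary.PropositionalEquality using (_≡_; refl; cong)
open import Relation.Nullary using (Dec; yes; no; ¬_; does)
open import Relation.Nullary.Decidable using (map′; ¬?; _×-dec_; _→-dec_)

-- One-line notation σ₁⋯σₙ, with both positions and values shifted to 0 , … , n ∸ 1.
Word : ℕ → ℕ → Set
Word m n = Vec (Fin m) n

words : ∀ m n → List (Word m n)
words m zero    = [ [] ]
words m (suc n) = cartesianProductWith _∷_ (allFin m) (words m n)

SameOrder : ∀ {m m′ k} → Word m k → Word m′ k → Set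
SameOrder u v = ∀ a b → lookup u a Fin.< lookup u b ⇔ lookup v a Fin.< lookup v b

sameOrder? : ∀ {m m′ k} (u : Word m k) (v : Word m′ k) → Dec (SameOrder u v)
sameOrder? u v = Fin.all? λ a → Fin.all? λ b →
  let p? = lookup u a Fin.<? lookup u b
      q? = lookup v a Fin.<? lookup v b
  in map′ (λ (f , g) → mk⇔ f g) (λ e → Equivalence.to e , Equivalence.from e)
          ((p? →-dec q?) ×-dec (q? →-dec p?))

Contains : ∀ {n} → Word 3 3 → Word n n → Set
Contains τ σ = ∃[ i₁ ] ∃[ i₂ ] ∃[ i₃ ] i₁ Fin.< i₂ × i₂ Fin.< i₃ ×
  SameOrder τ (lookup σ i₁ ∷ lookup σ i₂ ∷ lookup σ i₃ ∷ [])

contains? : ∀ {n} (τ : Word 3 3) (σ : Word n n) → Dec (Contains τ σ)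
contains? τ σ = Fin.any? λ i₁ → Fin.any? λ i₂ → Fin.any? λ i₃ →
  (i₁ Fin.<? i₂) ×-dec (i₂ Fin.<? i₃) ×-dec sameOrder? τ (lookup σ i₁ ∷ lookup σ i₂ ∷ lookup σ i₃ ∷ [])

Avoids : ∀ {n} → Word 3 3 → Word n n → Set
Avoids τ σ = ¬ Contains τ σ

avoids? : ∀ {n} (τ : Word 3 3) (σ : Word n n) → Dec (Avoids τ σ)
avoids? τ σ = ¬? (contains? τ σ)

IsPermutation : ∀ {n} → Word n n → Set
IsPermutation σ = Unique σ

isPermutation? : ∀ {n} (σ : Word n n) → Dec (IsPermutation σ)
isPermutation? = allPairs? λ x y → ¬? (x Fin.≟ y)

-- S n τ lists the permutations of length n avoiding τ, each exactly once.
S : ∀ n → Word 3 3 → List (Word n n)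
S n τ = filter (λ σ → isPermutation? σ ×-dec avoids? τ σ) (words n n)

[132] : Word 3 3
[132] = 0F ∷ 2F ∷ 1F ∷ []

data Step : Set where
  U D : Step

_≟ˢ_ : DecidableEquality Step
U ≟ˢ U = yes refl
U ≟ˢ D = no λ ()
D ≟ˢ U = no λ ()
D ≟ˢ D = yes refl

-- Only applied to lists of distinct values, so that "not <" means ">".
upDown : ∀ {n} → List (Fin n) → List Step
upDown []           = []
upDown (_ ∷ [])     = []
upDown (x ∷ y ∷ xs) = (if does (x Fin.<? y) then U else D) ∷ upDown (y ∷ xs)

subsequences : ∀ {A : Set} → List A → List (List A)
subsequences []       = [ [] ]
subsequences (x ∷ xs) = map (x ∷_) (subsequences xs) ++ subsequences xs

-- As W is nonempty and k is positive, such a subsequence has at least two entries.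
Repeats : ∀ {n} → List⁺ Step → List (Fin n) → Set
Repeats W xs = ∃[ k ] 1 ℕ.≤ k × upDown xs ≡ concat (replicate k (List⁺.toList W))

length-upDown : ∀ {n} (xs : List (Fin n)) → length (upDown xs) ℕ.≤ length xs
length-upDown []           = z≤n
length-upDown (_ ∷ [])     = z≤n
length-upDown (_ ∷ y ∷ xs) = s≤s (length-upDown (y ∷ xs))

k≤length-power : ∀ (W : List⁺ Step) k → k ℕ.≤ length (concat (replicate k (List⁺.toList W)))
k≤length-power W       zero    = z≤n
k≤length-power (w ∷ W) (suc k) = s≤s (begin
  k                      ≤⟨ k≤length-power (w ∷ W) k ⟩
  length Wᵏ              ≤⟨ ℕ.m≤n+m _ (length W) ⟩
  length W ℕ.+ length Wᵏ ≡⟨ List.length-++ W ⟨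
  length (W ++ Wᵏ)       ∎)
  where
  open ℕ.≤-Reasoning
  Wᵏ = concat (replicate k (w ∷ W))

repeats? : ∀ {n} (W : List⁺ Step) (xs : List (Fin n)) → Dec (Repeats W xs)
repeats? W xs = map′ (λ (k , _ , p) → k , p) (λ (k , 1≤k , eq) → k , s≤s (bound k eq) , 1≤k , eq)
  (ℕ.anyUpTo? (λ k → (1 ℕ.≤? k) ×-dec List.≡-dec _≟ˢ_ _ _) (suc (length xs)))
  where
  open ℕ.≤-Reasoning
  bound : ∀ k → upDown xs ≡ concat (replicate k (List⁺.toList W)) → k ℕ.≤ length xs
  bound k eq = begin
    k                                              ≤⟨ k≤length-power W k ⟩
    length (concat (replicate k (List⁺.toList W))) ≡⟨ cong length eq ⟨
    length (upDown xs)                             ≤⟨ length-upDown xs ⟩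
    length xs                                      ∎

-- The base value 0 is the result when no subsequence repeats W.
L : ∀ {n} → List⁺ Step → Word n n → ℕ
L W σ = max 0 (map length (filter (repeats? W) (subsequences (Vec.toList σ))))

U³D : List⁺ Step
U³D = U ∷ (U ∷ U ∷ D ∷ [])

-- Arithmetic mean, i.e. the expectation under the uniform measure; it is 0 on the
-- empty list, a case that does not occur for S n [132], which contains the identity.
mean : ∀ {A : Set} → List A → (A → ℕ) → ℚ
mean []         f = 0ℚ
mean xs@(_ ∷ _) f = + sum (map f xs) ℚ./ length xs

E[av_] : Word 3 3 → ∀ n → (Word n n → ℕ) → ℚ
E[av τ ] n = mean (S n τ)

-- xₙ / yₙ → 1; the ratio need only be defined for large n.
infix 4 _∼_
_∼_ : (ℕ → ℚ) → (ℕ → ℚ) → Set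
x ∼ y = ∀ ε → 0ℚ ℚ.< ε → ∃[ N ] ∀ n → N ℕ.≤ n →
  Σ[ y≢0 ∈ ℚ.NonZero (y n) ] ∣ (x n ÷ y n) {{y≢0}} ℚ.- 1ℚ ∣ ℚ.< ε

{-# OPTIONS --safe #-}
-- A 132-avoiding permutation with last entry k is R L k with R > k > L, so 132-avoiding permutations
-- are coded by binary trees. Reading such a permutation from left to right, a tree r l runs through r,
-- then falls to l, then rises to its root; hence the longest subsequence following UUUDUUUD… obeys a
-- recursion on the tree whose state is the number c of completed blocks together with the phase
-- h < 4 of the current block, and the longest repetition of UUUD differs from 4 c by at most 4.
--
-- A block is completed at each subtree whose left child has phase 3, so the expectation of c is the
-- average number of such subtrees. Averages of this kind are computed up to an error that stays
-- bounded: prescribing one child of a random subtree to be arbitrary, empty, or free of completed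
-- blocks with phase at most 1 or 2 multiplies them by 1/2, 1/4, 1/3 or 3/8. The recursion for the
-- states becomes a linear system, and since a tree with n nodes has n + 1 leaves, it
-- gives n/11 for the average of c.
module Submission where

open import Defs

-- Singularity analysis is replaced by exact identities between totals over all trees of one size;
-- no asymptotics of the Catalan numbers enters. Totals depend on a function of trees only through
-- its generating function. That of `f ⊗ g` is z F G, so on totals `⊗` is commutative and
-- associative although it is neither pointwise. Commutativity makes the two children
-- interchangeable; as every subtree but the whole tree is a child, prescribing nothing about the
-- sibling costs a factor 1/2, up to one value of the function per tree. Associativity is a tree
-- rotation: it moves a condition on a grandchild to a child, so that a recursive description of a
-- class K of children becomes a linear equation for the multiplier of K. The multiplier is
-- K(1/4)/4, where K(z) is the generating function of the class and 1/4 the singularity of the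
-- Catalan series. The values 2, 1, 4/3 and 3/2 at 1/4 of the Catalan series, 1, 1/(1 - z) and (1 -
-- z)/(1 - 2z) explain 1/2, 1/4, 1/3 and 3/8. Classes of trees with a completed block get no
-- multiplier of their own; their frequencies are the unknowns of the linear system.

module Counting where

  open import Data.Fin as Fin using (Fin)
  open import Data.Fin.Patterns using (0F; 1F; 2F; 3F)
  import Data.Fin.Properties as Fin
  open import Data.Integer as ℤ using (ℤ; +_; 0ℤ; 1ℤ; ∣_∣; _+_; _*_; -_)
  import Data.Integer.Properties as ℤ
  open import Data.Integer.Tactic.RingSolver using (solve-∀)
  open import Data.List.Base using (List; []; _∷_; [_]; _++_; map; length; cartesianProductWith)
  open import Data.List.Membership.Propositional using (_∈_)
  import Data.List.Membership.Propositional.Properties as ∈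
  open import Data.List.Relation.Unary.All as All using (All; []; _∷_)
  open import Data.List.Relation.Unary.Any using (here; there)
  open import Data.List.Relation.Unary.AllPairs using ([]; _∷_)
  open import Data.List.Relation.Unary.Unique.Propositional using (Unique)
  import Data.List.Relation.Unary.Unique.Propositional.Properties as Unique
  open import Data.Nat as ℕ using (ℕ; zero; suc; z≤n; s≤s; _≤_)
  import Data.Nat.Properties as ℕ
  open import Data.Product using (∃-syntax; _×_; _,_; proj₁; proj₂)
  open import Data.Sum using (inj₁; inj₂)
  open import Data.Bool using (if_then_else_; true; false)
  open import Function using (_∘_)
  open import Relation.Binary.PropositionalEquality using (_≡_; refl; sym; trans; cong; cong₂; subst; module ≡-Reasoning)
  open import Relation.Nullary using (does)
  open import Relation.Nullary.Decidable using (True; toWitness)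
  open import Data.Nat.ListAction using (sum)

  -- Binary trees listed by number of nodes.

  data Tree : Set where
    leaf : Tree
    node : Tree → Tree → Tree

  size : Tree → ℕ
  size leaf       = 0
  size (node r l) = suc (size r ℕ.+ size l)

  products : (ℕ → List Tree) → (ℕ → List Tree) → ℕ → List Tree
  products R L zero    = cartesianProductWith node (R 0) (L 0)
  products R L (suc n) = cartesianProductWith node (R 0) (L (suc n)) ++ products (R ∘ suc) L n

  -- The fuel only makes the recursion structural: it is irrelevant from n on.
  treesWithin : ℕ → ℕ → List Tree
  treesWithin fuel       zero    = [ leaf ]
  treesWithin zero       (suc n) = []
  treesWithin (suc fuel) (suc n) = products (treesWithin fuel) (treesWithin fuel) n

  trees : ℕ → List Tree
  trees n = treesWithin n n

  products-cong : ∀ {R R′ L L′} n → (∀ {k} → k ℕ.≤ n → R k ≡ R′ k) → (∀ {k} → k ℕ.≤ n → L k ≡ L′ k) →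
                  products R L n ≡ products R′ L′ n
  products-cong zero    eqR eqL = cong₂ (cartesianProductWith node) (eqR z≤n) (eqL z≤n)
  products-cong (suc n) eqR eqL = cong₂ _++_
    (cong₂ (cartesianProductWith node) (eqR z≤n) (eqL ℕ.≤-refl))
    (products-cong n (eqR ∘ s≤s) (eqL ∘ ℕ.m≤n⇒m≤1+n))

  treesWithin-enough : ∀ {a b n} → n ℕ.≤ a → n ℕ.≤ b → treesWithin a n ≡ treesWithin b n
  treesWithin-enough z≤n     z≤n     = refl
  treesWithin-enough (s≤s p) (s≤s q) = products-cong _
    (λ k≤n → treesWithin-enough (ℕ.≤-trans k≤n p) (ℕ.≤-trans k≤n q))
    (λ k≤n → treesWithin-enough (ℕ.≤-trans k≤n p) (ℕ.≤-trans k≤n q))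

  trees-suc : ∀ n → trees (suc n) ≡ products trees trees n
  trees-suc n = products-cong n (λ k≤n → treesWithin-enough k≤n ℕ.≤-refl) (λ k≤n → treesWithin-enough k≤n ℕ.≤-refl)

  ∈-products⁺ : ∀ R L i j {r l} → r ∈ R i → l ∈ L j → node r l ∈ products R L (i ℕ.+ j)
  ∈-products⁺ R L zero    zero    r∈ l∈ = ∈.∈-cartesianProductWith⁺ node r∈ l∈
  ∈-products⁺ R L zero    (suc j) r∈ l∈ = ∈.∈-++⁺ˡ (∈.∈-cartesianProductWith⁺ node r∈ l∈)
  ∈-products⁺ R L (suc i) j       r∈ l∈ = ∈.∈-++⁺ʳ (cartesianProductWith node (R 0) (L (suc i ℕ.+ j)))
                                                   (∈-products⁺ (R ∘ suc) L i j r∈ l∈)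

  ∈-products⁻ : ∀ R L n {t} → t ∈ products R L n →
                ∃[ i ] ∃[ j ] ∃[ r ] ∃[ l ] i ℕ.+ j ≡ n × r ∈ R i × l ∈ L j × t ≡ node r l
  ∈-products⁻ R L zero t∈ with ∈.∈-cartesianProductWith⁻ node (R 0) (L 0) t∈
  ... | r , l , r∈ , l∈ , eq = 0 , 0 , r , l , refl , r∈ , l∈ , eq
  ∈-products⁻ R L (suc n) t∈ with ∈.∈-++⁻ (cartesianProductWith node (R 0) (L (suc n))) t∈
  ... | inj₁ t∈₁ with ∈.∈-cartesianProductWith⁻ node (R 0) (L (suc n)) t∈₁
  ...   | r , l , r∈ , l∈ , eq = 0 , suc n , r , l , refl , r∈ , l∈ , eq
  ∈-products⁻ R L (suc n) t∈ | inj₂ t∈₂ with ∈-products⁻ (R ∘ suc) L n t∈₂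
  ...   | i , j , r , l , i+j≡n , r∈ , l∈ , eq = suc i , j , r , l , cong suc i+j≡n , r∈ , l∈ , eq

  ∈-trees : ∀ t → t ∈ trees (size t)
  ∈-trees leaf       = here refl
  ∈-trees (node r l) rewrite trees-suc (size r ℕ.+ size l) =
    ∈-products⁺ trees trees (size r) (size l) (∈-trees r) (∈-trees l)

  ∈-treesWithin⇒size : ∀ d n {t} → t ∈ treesWithin d n → size t ≡ n
  ∈-treesWithin⇒size d       zero    (here refl) = refl
  ∈-treesWithin⇒size (suc d) (suc n) t∈ with ∈-products⁻ (treesWithin d) (treesWithin d) n t∈
  ... | i , j , r , l , i+j≡n , r∈ , l∈ , refl =
    cong suc (trans (cong₂ ℕ._+_ (∈-treesWithin⇒size d i r∈) (∈-treesWithin⇒size d j l∈)) i+j≡n)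

  node-injective : ∀ {r r′ l l′} → node r l ≡ node r′ l′ → r ≡ r′ × l ≡ l′
  node-injective refl = refl , refl

  -- The offset k is there for the induction, which replaces R by R ∘ suc.
  products-unique : ∀ {R L} k n → (∀ i → Unique (R i)) → (∀ i → Unique (L i)) →
                    (∀ i {r} → r ∈ R i → size r ≡ k ℕ.+ i) → Unique (products R L n)
  products-unique k zero uR uL sz = Unique.cartesianProductWith⁺ node node-injective (uR 0) (uL 0)
  products-unique {R} {L} k (suc n) uR uL sz = Unique.++⁺
    (Unique.cartesianProductWith⁺ node node-injective (uR 0) (uL (suc n)))
    (products-unique (suc k) n (uR ∘ suc) uL (λ i r∈ → trans (sz (suc i) r∈) (ℕ.+-suc k i)))
    disjoint
    where
    disjoint : ∀ {t} → t ∈ cartesianProductWith node (R 0) (L (suc n)) × t ∈ products (R ∘ suc) L n → _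
    disjoint (t∈₁ , t∈₂) with ∈.∈-cartesianProductWith⁻ node (R 0) (L (suc n)) t∈₁ | ∈-products⁻ (R ∘ suc) L n t∈₂
    ... | r , _ , r∈ , _ , refl | i , _ , _ , _ , _ , r∈′ , _ , refl =
      ℕ.0≢1+n (ℕ.+-cancelˡ-≡ k _ _ (trans (sym (sz 0 r∈)) (sz (suc i) r∈′)))

  treesWithin-unique : ∀ d n → Unique (treesWithin d n)
  treesWithin-unique d       zero    = [] ∷ []
  treesWithin-unique zero    (suc n) = []
  treesWithin-unique (suc d) (suc n) =
    products-unique 0 n (treesWithin-unique d) (treesWithin-unique d) (λ i → ∈-treesWithin⇒size d i)


  -- Cauchy products and totals over the trees of one size.

  infixl 7 _✶_
  _✶_ : (ℕ → ℤ) → (ℕ → ℤ) → ℕ → ℤ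
  (a ✶ b) zero    = a 0 * b 0
  (a ✶ b) (suc n) = a 0 * b (suc n) + ((a ∘ suc) ✶ b) n

  ✶-cong : ∀ {a a′ b b′} n → (∀ {k} → k ℕ.≤ n → a k ≡ a′ k) → (∀ {k} → k ℕ.≤ n → b k ≡ b′ k) →
           (a ✶ b) n ≡ (a′ ✶ b′) n
  ✶-cong zero    p q = cong₂ _*_ (p z≤n) (q z≤n)
  ✶-cong (suc n) p q = cong₂ _+_ (cong₂ _*_ (p z≤n) (q ℕ.≤-refl)) (✶-cong n (p ∘ s≤s) (q ∘ ℕ.m≤n⇒m≤1+n))

  -- The defining recursion peels off the first term of `a`; the induction for commutativity needs
  -- to peel off that of `b` instead.
  ✶-suc : ∀ a b n → (a ✶ b) (suc n) ≡ (a ✶ (b ∘ suc)) n + a (suc n) * b 0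
  ✶-suc a b zero    = refl
  ✶-suc a b (suc n) = trans (cong (_+_ (a 0 * b (suc (suc n)))) (✶-suc (a ∘ suc) b n))
                            (sym (ℤ.+-assoc (a 0 * b (suc (suc n))) _ (a (suc (suc n)) * b 0)))

  ✶-comm : ∀ a b n → (a ✶ b) n ≡ (b ✶ a) n
  ✶-comm a b zero    = ℤ.*-comm (a 0) (b 0)
  ✶-comm a b (suc n) = trans (✶-suc a b n)
    (trans (ℤ.+-comm _ (a (suc n) * b 0))
           (cong₂ _+_ (ℤ.*-comm (a (suc n)) (b 0)) (✶-comm a (b ∘ suc) n)))

  ✶-linearˡ : ∀ k a b c n → ((λ i → k * a i + b i) ✶ c) n ≡ k * (a ✶ c) n + (b ✶ c) n
  ✶-linearˡ k a b c zero    = lemma k (a 0) (b 0) (c 0)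
    where
    lemma : ∀ k x y z → (k * x + y) * z ≡ k * (x * z) + y * z
    lemma = solve-∀
  ✶-linearˡ k a b c (suc n) = trans (cong (_+_ ((k * a 0 + b 0) * c (suc n))) (✶-linearˡ k (a ∘ suc) (b ∘ suc) c n))
    (lemma k (a 0) (b 0) (c (suc n)) (((a ∘ suc) ✶ c) n) (((b ∘ suc) ✶ c) n))
    where
    lemma : ∀ k x y z u v → (k * x + y) * z + (k * u + v) ≡ k * (x * z + u) + (y * z + v)
    lemma = solve-∀

  ✶-assoc : ∀ a b c n → ((a ✶ b) ✶ c) n ≡ (a ✶ (b ✶ c)) n
  ✶-assoc a b c zero    = ℤ.*-assoc (a 0) (b 0) (c 0)
  ✶-assoc a b c (suc n) = trans (cong (_+_ (a 0 * b 0 * c (suc n))) (✶-linearˡ (a 0) (b ∘ suc) ((a ∘ suc) ✶ b) c n))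
    (trans (lemma (a 0) (b 0) (c (suc n)) (((b ∘ suc) ✶ c) n) ((((a ∘ suc) ✶ b) ✶ c) n))
           (cong (λ z → a 0 * (b 0 * c (suc n) + ((b ∘ suc) ✶ c) n) + z) (✶-assoc (a ∘ suc) b c n)))
    where
    lemma : ∀ x y z u v → x * y * z + (x * u + v) ≡ x * (y * z + u) + v
    lemma = solve-∀

  -- Multiplication of a generating function by z: it pays for the root that `node` adds.
  shift : (ℕ → ℤ) → ℕ → ℤ
  shift a zero    = 0ℤ
  shift a (suc n) = a n

  shift-cong : ∀ {a b} → (∀ n → a n ≡ b n) → ∀ n → shift a n ≡ shift b n
  shift-cong p zero    = refl
  shift-cong p (suc n) = p n

  shift-✶ : ∀ a b n → (shift a ✶ b) n ≡ shift (a ✶ b) n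
  shift-✶ a b zero    = ℤ.*-zeroˡ (b 0)
  shift-✶ a b (suc n) = trans (cong (_+ (a ✶ b) n) (ℤ.*-zeroˡ (b (suc n)))) (ℤ.+-identityˡ _)

  ✶-shift : ∀ a b n → (a ✶ shift b) n ≡ shift (a ✶ b) n
  ✶-shift a b n = trans (✶-comm a (shift b) n)
    (trans (shift-✶ b a n) (shift-cong (✶-comm b a) n))

  total : List Tree → (Tree → ℤ) → ℤ
  total []       f = 0ℤ
  total (t ∷ ts) f = f t + total ts f

  ⟦_⟧ : (Tree → ℤ) → ℕ → ℤ
  ⟦ f ⟧ n = total (trees n) f

  total-cong : ∀ ts {f g} → (∀ t → f t ≡ g t) → total ts f ≡ total ts g
  total-cong []       p = refl
  total-cong (t ∷ ts) p = cong₂ _+_ (p t) (total-cong ts p)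

  total-++ : ∀ ts us f → total (ts ++ us) f ≡ total ts f + total us f
  total-++ []       us f = sym (ℤ.+-identityˡ _)
  total-++ (t ∷ ts) us f = trans (cong (_+_ (f t)) (total-++ ts us f)) (sym (ℤ.+-assoc (f t) _ _))

  infixl 6 _⊕_
  infixl 7 _⊙_ _⊗_

  _⊕_ : (Tree → ℤ) → (Tree → ℤ) → Tree → ℤ
  (f ⊕ g) t = f t + g t

  _⊙_ : ℤ → (Tree → ℤ) → Tree → ℤ
  (k ⊙ f) t = k * f t

  -- The value 0 at `leaf` makes the generating function exactly z F G, see `⟦⊗⟧`.
  _⊗_ : (Tree → ℤ) → (Tree → ℤ) → Tree → ℤ
  (f ⊗ g) leaf       = 0ℤ
  (f ⊗ g) (node r l) = f r * g l

  total-⊕ : ∀ ts f g → total ts (f ⊕ g) ≡ total ts f + total ts g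
  total-⊕ []       f g = refl
  total-⊕ (t ∷ ts) f g = trans (cong (_+_ (f t + g t)) (total-⊕ ts f g)) (lemma (f t) (g t) (total ts f) (total ts g))
    where
    lemma : ∀ a b c d → a + b + (c + d) ≡ a + c + (b + d)
    lemma = solve-∀

  total-⊙ : ∀ ts k f → total ts (k ⊙ f) ≡ k * total ts f
  total-⊙ []       k f = sym (ℤ.*-zeroʳ k)
  total-⊙ (t ∷ ts) k f = trans (cong (_+_ (k * f t)) (total-⊙ ts k f)) (sym (ℤ.*-distribˡ-+ k (f t) (total ts f)))

  total-map : ∀ r ls f g → total (map (node r) ls) (f ⊗ g) ≡ f r * total ls g
  total-map r []       f g = sym (ℤ.*-zeroʳ (f r))
  total-map r (l ∷ ls) f g = trans (cong (_+_ (f r * g l)) (total-map r ls f g)) (sym (ℤ.*-distribˡ-+ (f r) (g l) (total ls g)))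

  total-cartesianProductWith : ∀ rs ls f g →
    total (cartesianProductWith node rs ls) (f ⊗ g) ≡ total rs f * total ls g
  total-cartesianProductWith []       ls f g = sym (ℤ.*-zeroˡ (total ls g))
  total-cartesianProductWith (r ∷ rs) ls f g = trans (total-++ (map (node r) ls) _ (f ⊗ g))
    (trans (cong₂ _+_ (total-map r ls f g) (total-cartesianProductWith rs ls f g))
           (sym (ℤ.*-distribʳ-+ (total ls g) (f r) (total rs f))))

  total-products : ∀ R L f g n →
    total (products R L n) (f ⊗ g) ≡ ((λ i → total (R i) f) ✶ (λ i → total (L i) g)) n
  total-products R L f g zero    = total-cartesianProductWith (R 0) (L 0) f g
  total-products R L f g (suc n) = trans (total-++ (cartesianProductWith node (R 0) (L (suc n))) _ (f ⊗ g))
    (cong₂ _+_ (total-cartesianProductWith (R 0) (L (suc n)) f g) (total-products (R ∘ suc) L f g n))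

  ⟦⊗⟧ : ∀ f g n → ⟦ f ⊗ g ⟧ n ≡ shift (⟦ f ⟧ ✶ ⟦ g ⟧) n
  ⟦⊗⟧ f g zero    = refl
  ⟦⊗⟧ f g (suc n) = trans (cong (λ ts → total ts (f ⊗ g)) (trees-suc n)) (total-products trees trees f g n)

  infix 4 _≃_
  _≃_ : (Tree → ℤ) → (Tree → ℤ) → Set
  f ≃ g = ∀ n → ⟦ f ⟧ n ≡ ⟦ g ⟧ n

  ≗⇒≃ : ∀ {f g} → (∀ t → f t ≡ g t) → f ≃ g
  ≗⇒≃ p n = total-cong (trees n) p

  ⊕-cong : ∀ {f f′ g g′} → f ≃ f′ → g ≃ g′ → f ⊕ g ≃ f′ ⊕ g′
  ⊕-cong {f} {f′} {g} {g′} p q n =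
    trans (total-⊕ (trees n) f g) (trans (cong₂ _+_ (p n) (q n)) (sym (total-⊕ (trees n) f′ g′)))

  -- Only the totals agree, not the values at a tree: Cauchy products commute.
  ⊗-swap : ∀ f g → f ⊗ g ≃ g ⊗ f
  ⊗-swap f g n = trans (⟦⊗⟧ f g n) (trans (shift-cong (✶-comm ⟦ f ⟧ ⟦ g ⟧) n) (sym (⟦⊗⟧ g f n)))

  -- Both sides have generating function z² F G H.
  ⊗-assoc : ∀ f g h → f ⊗ (g ⊗ h) ≃ (f ⊗ g) ⊗ h
  ⊗-assoc f g h n = begin
    ⟦ f ⊗ (g ⊗ h) ⟧ n                            ≡⟨ ⟦⊗⟧ f (g ⊗ h) n ⟩
    shift (⟦ f ⟧ ✶ ⟦ g ⊗ h ⟧) n                  ≡⟨ shift-cong (λ m → ✶-cong m (λ _ → refl) (λ {k} _ → ⟦⊗⟧ g h k)) n ⟩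
    shift (⟦ f ⟧ ✶ shift (⟦ g ⟧ ✶ ⟦ h ⟧)) n      ≡⟨ shift-cong (✶-shift ⟦ f ⟧ (⟦ g ⟧ ✶ ⟦ h ⟧)) n ⟩
    shift (shift (⟦ f ⟧ ✶ (⟦ g ⟧ ✶ ⟦ h ⟧))) n    ≡⟨ shift-cong (shift-cong (✶-assoc ⟦ f ⟧ ⟦ g ⟧ ⟦ h ⟧)) n ⟨
    shift (shift ((⟦ f ⟧ ✶ ⟦ g ⟧) ✶ ⟦ h ⟧)) n    ≡⟨ shift-cong (shift-✶ (⟦ f ⟧ ✶ ⟦ g ⟧) ⟦ h ⟧) n ⟨
    shift (shift (⟦ f ⟧ ✶ ⟦ g ⟧) ✶ ⟦ h ⟧) n      ≡⟨ shift-cong (λ m → ✶-cong m (λ {k} _ → ⟦⊗⟧ f g k) (λ _ → refl)) n ⟨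
    shift (⟦ f ⊗ g ⟧ ✶ ⟦ h ⟧) n                  ≡⟨ ⟦⊗⟧ (f ⊗ g) h n ⟨
    ⟦ (f ⊗ g) ⊗ h ⟧ n                            ∎
    where open ≡-Reasoning

  ⊗-distribˡ : ∀ f g h → f ⊗ (g ⊕ h) ≃ f ⊗ g ⊕ f ⊗ h
  ⊗-distribˡ f g h = ≗⇒≃ λ { leaf → refl ; (node r l) → ℤ.*-distribˡ-+ (f r) (g l) (h l) }

  -- Sums over subtrees, and functions for which they are negligible.

  𝟙 : Tree → ℤ
  𝟙 _ = 1ℤ

  Σsub : (Tree → ℤ) → Tree → ℤ
  Σsub f leaf       = f leaf
  Σsub f (node r l) = f (node r l) + (Σsub f r + Σsub f l)

  Σsub-⊕ : ∀ f g t → Σsub (f ⊕ g) t ≡ Σsub f t + Σsub g t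
  Σsub-⊕ f g leaf       = refl
  Σsub-⊕ f g (node r l) = trans (cong (_+_ (f (node r l) + g (node r l))) (cong₂ _+_ (Σsub-⊕ f g r) (Σsub-⊕ f g l)))
    (lemma (f (node r l)) (g (node r l)) (Σsub f r) (Σsub g r) (Σsub f l) (Σsub g l))
    where
    lemma : ∀ a b c d e h → a + b + ((c + d) + (e + h)) ≡ a + (c + e) + (b + (d + h))
    lemma = solve-∀

  Σsub-⊙ : ∀ k f t → Σsub (k ⊙ f) t ≡ k * Σsub f t
  Σsub-⊙ k f leaf       = refl
  Σsub-⊙ k f (node r l) = trans (cong (_+_ (k * f (node r l))) (cong₂ _+_ (Σsub-⊙ k f r) (Σsub-⊙ k f l)))
    (lemma k (f (node r l)) (Σsub f r) (Σsub f l))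
    where
    lemma : ∀ k a b c → k * a + (k * b + k * c) ≡ k * (a + (b + c))
    lemma = solve-∀

  ⟦Σsub⟧-⊕ : ∀ f g n → ⟦ Σsub (f ⊕ g) ⟧ n ≡ ⟦ Σsub f ⟧ n + ⟦ Σsub g ⟧ n
  ⟦Σsub⟧-⊕ f g n = trans (total-cong (trees n) (Σsub-⊕ f g)) (total-⊕ (trees n) (Σsub f) (Σsub g))

  ⟦Σsub⟧-⊙ : ∀ k f n → ⟦ Σsub (k ⊙ f) ⟧ n ≡ k * ⟦ Σsub f ⟧ n
  ⟦Σsub⟧-⊙ k f n = trans (total-cong (trees n) (Σsub-⊙ k f)) (total-⊙ (trees n) k (Σsub f))

  Σsub-unfold : ∀ f t → Σsub f t ≡ (f ⊕ (Σsub f ⊗ 𝟙 ⊕ 𝟙 ⊗ Σsub f)) t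
  Σsub-unfold f leaf       = sym (ℤ.+-identityʳ (f leaf))
  Σsub-unfold f (node r l) = lemma (f (node r l)) (Σsub f r) (Σsub f l)
    where
    lemma : ∀ a b c → a + (b + c) ≡ a + (b * 1ℤ + 1ℤ * c)
    lemma = solve-∀

  -- Left and right subtrees contribute equally to the total, so the generating function S of
  -- `Σsub f` satisfies S = F + 2 z S C with C the Catalan series.
  ⟦Σsub⟧-unfold : ∀ f n → ⟦ Σsub f ⟧ n ≡ ⟦ f ⟧ n + (+ 2) * shift (⟦ Σsub f ⟧ ✶ ⟦ 𝟙 ⟧) n
  ⟦Σsub⟧-unfold f n = begin
    ⟦ Σsub f ⟧ n                                       ≡⟨ total-cong (trees n) (Σsub-unfold f) ⟩
    ⟦ f ⊕ (Σsub f ⊗ 𝟙 ⊕ 𝟙 ⊗ Σsub f) ⟧ n               ≡⟨ total-⊕ (trees n) f _ ⟩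
    ⟦ f ⟧ n + ⟦ Σsub f ⊗ 𝟙 ⊕ 𝟙 ⊗ Σsub f ⟧ n           ≡⟨ cong (_+_ (⟦ f ⟧ n)) (total-⊕ (trees n) (Σsub f ⊗ 𝟙) _) ⟩
    ⟦ f ⟧ n + (⟦ Σsub f ⊗ 𝟙 ⟧ n + ⟦ 𝟙 ⊗ Σsub f ⟧ n)   ≡⟨ cong (λ z → ⟦ f ⟧ n + (⟦ Σsub f ⊗ 𝟙 ⟧ n + z)) (⊗-swap 𝟙 (Σsub f) n) ⟩
    ⟦ f ⟧ n + (⟦ Σsub f ⊗ 𝟙 ⟧ n + ⟦ Σsub f ⊗ 𝟙 ⟧ n)   ≡⟨ cong (_+_ (⟦ f ⟧ n)) (double _) ⟩
    ⟦ f ⟧ n + (+ 2) * ⟦ Σsub f ⊗ 𝟙 ⟧ n                 ≡⟨ cong (λ z → ⟦ f ⟧ n + (+ 2) * z) (⟦⊗⟧ (Σsub f) 𝟙 n) ⟩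
    ⟦ f ⟧ n + (+ 2) * shift (⟦ Σsub f ⟧ ✶ ⟦ 𝟙 ⟧) n     ∎
    where
    open ≡-Reasoning
    double : ∀ a → a + a ≡ (+ 2) * a
    double = solve-∀

  -- `⟦Σsub⟧-unfold` computes each total of `Σsub f` from the total of `f` and from totals of
  -- `Σsub f` at smaller sizes. Hence the totals of `f` determine those of `Σsub f`, by strong
  -- induction.
  Σsub-≃ : ∀ {f g} → f ≃ g → Σsub f ≃ Σsub g
  Σsub-≃ {f} {g} p n = below n ℕ.≤-refl
    where
    below : ∀ n {k} → k ℕ.≤ n → ⟦ Σsub f ⟧ k ≡ ⟦ Σsub g ⟧ k
    step  : ∀ n {k} → k ℕ.≤ n → shift (⟦ Σsub f ⟧ ✶ ⟦ 𝟙 ⟧) k ≡ shift (⟦ Σsub g ⟧ ✶ ⟦ 𝟙 ⟧) k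
    below n {k} k≤n = trans (⟦Σsub⟧-unfold f k)
      (trans (cong₂ (λ x y → x + (+ 2) * y) (p k) (step n k≤n)) (sym (⟦Σsub⟧-unfold g k)))
    step n       z≤n               = refl
    step (suc n) (s≤s {m = k} k≤n) = ✶-cong k (λ j≤k → below n (ℕ.≤-trans j≤k k≤n)) (λ _ → refl)

  count : ℕ → ℕ
  count n = length (trees n)

  -- A sum over subtrees normally grows like n on average; here its average over the trees with n
  -- nodes stays bounded.
  Negligible : (Tree → ℤ) → Set
  Negligible f = ∃[ c ] ∀ n → ∣ ⟦ Σsub f ⟧ n ∣ ℕ.≤ c ℕ.* count n

  negligible-≃ : ∀ {f g} → f ≃ g → Negligible f → Negligible g
  negligible-≃ f≃g (c , p) = c , λ n → subst (λ z → ∣ z ∣ ℕ.≤ c ℕ.* count n) (Σsub-≃ f≃g n) (p n)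

  infixl 6 _⊞_
  _⊞_ : ∀ {f g} → Negligible f → Negligible g → Negligible (f ⊕ g)
  _⊞_ {f} {g} (c , p) (d , q) = c ℕ.+ d , λ n → begin
    ∣ ⟦ Σsub (f ⊕ g) ⟧ n ∣                  ≡⟨ cong ∣_∣ (⟦Σsub⟧-⊕ f g n) ⟩
    ∣ ⟦ Σsub f ⟧ n + ⟦ Σsub g ⟧ n ∣         ≤⟨ ℤ.∣i+j∣≤∣i∣+∣j∣ (⟦ Σsub f ⟧ n) (⟦ Σsub g ⟧ n) ⟩
    ∣ ⟦ Σsub f ⟧ n ∣ ℕ.+ ∣ ⟦ Σsub g ⟧ n ∣   ≤⟨ ℕ.+-mono-≤ (p n) (q n) ⟩
    c ℕ.* count n ℕ.+ d ℕ.* count n         ≡⟨ ℕ.*-distribʳ-+ (count n) c d ⟨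
    (c ℕ.+ d) ℕ.* count n                   ∎
    where open ℕ.≤-Reasoning

  infixr 7 _⊡_
  _⊡_ : ∀ k {f} → Negligible f → Negligible (k ⊙ f)
  _⊡_ k {f} (c , p) = ∣ k ∣ ℕ.* c , λ n → begin
    ∣ ⟦ Σsub (k ⊙ f) ⟧ n ∣       ≡⟨ cong ∣_∣ (⟦Σsub⟧-⊙ k f n) ⟩
    ∣ k * ⟦ Σsub f ⟧ n ∣         ≡⟨ ℤ.abs-* k _ ⟩
    ∣ k ∣ ℕ.* ∣ ⟦ Σsub f ⟧ n ∣   ≤⟨ ℕ.*-monoʳ-≤ ∣ k ∣ (p n) ⟩
    ∣ k ∣ ℕ.* (c ℕ.* count n)    ≡⟨ ℕ.*-assoc ∣ k ∣ c _ ⟨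
    ∣ k ∣ ℕ.* c ℕ.* count n      ∎
    where open ℕ.≤-Reasoning

  -- Needed for the error of `half`, which is the value at the root, summed over all trees.
  Bounded : (Tree → ℤ) → Set
  Bounded f = ∃[ c ] ∀ t → ∣ f t ∣ ℕ.≤ c

  ⊗-bounded : ∀ {f g} → Bounded f → Bounded g → Bounded (f ⊗ g)
  ⊗-bounded {f} {g} (c , p) (d , q) = c ℕ.* d , λ
    { leaf       → z≤n
    ; (node r l) → ℕ.≤-trans (ℕ.≤-reflexive (ℤ.abs-* (f r) (g l))) (ℕ.*-mono-≤ (p r) (q l)) }

  ⊕-bounded : ∀ {f g} → Bounded f → Bounded g → Bounded (f ⊕ g)
  ⊕-bounded {f} {g} (c , p) (d , q) = c ℕ.+ d , λ t →
    ℕ.≤-trans (ℤ.∣i+j∣≤∣i∣+∣j∣ (f t) (g t)) (ℕ.+-mono-≤ (p t) (q t))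

  ⊙-bounded : ∀ k {f} → Bounded f → Bounded (k ⊙ f)
  ⊙-bounded k {f} (c , p) = ∣ k ∣ ℕ.* c , λ t →
    ℕ.≤-trans (ℕ.≤-reflexive (ℤ.abs-* k (f t))) (ℕ.*-monoʳ-≤ ∣ k ∣ (p t))

  total-bounded : ∀ ts {f c} → (∀ t → ∣ f t ∣ ℕ.≤ c) → ∣ total ts f ∣ ℕ.≤ c ℕ.* length ts
  total-bounded []       p = z≤n
  total-bounded (t ∷ ts) {f} {c} p = ℕ.≤-trans (ℤ.∣i+j∣≤∣i∣+∣j∣ (f t) (total ts f))
    (ℕ.≤-trans (ℕ.+-mono-≤ (p t) (total-bounded ts p)) (ℕ.≤-reflexive (sym (ℕ.*-suc c (length ts)))))

  -- Every proper subtree is a left or a right child of exactly one subtree.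
  Σsub-children : ∀ f t → Σsub f t ≡ f t + (Σsub (f ⊗ 𝟙) t + Σsub (𝟙 ⊗ f) t)
  Σsub-children f leaf       = sym (ℤ.+-identityʳ (f leaf))
  Σsub-children f (node r l) = trans (cong (_+_ (f (node r l))) (cong₂ _+_ (Σsub-children f r) (Σsub-children f l)))
    (lemma (f (node r l)) (f r) (f l) (Σsub (f ⊗ 𝟙) r) (Σsub (𝟙 ⊗ f) r) (Σsub (f ⊗ 𝟙) l) (Σsub (𝟙 ⊗ f) l))
    where
    lemma : ∀ a b c d e h i → a + ((b + (d + e)) + (c + (h + i))) ≡ a + ((b * 1ℤ + (d + h)) + (1ℤ * c + (e + i)))
    lemma = solve-∀

  -- Up to negligible terms, the factor 𝟙 (an arbitrary child) acts as 1/2; likewise, the factors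
  -- ε, Fresh 1F and Fresh 2F act as 1/4, 1/3 and 3/8 in the lemmas quarter, third and three-eighths.
  half : ∀ f → Bounded f → Negligible (+ 2 ⊙ (𝟙 ⊗ f) ⊕ - 1ℤ ⊙ f)
  half f (c , p) = c , λ n → subst (ℕ._≤ c ℕ.* count n) (sym (eq n)) (total-bounded (trees n) p)
    where
    lemma : ∀ x y z → y ≡ x + (z + z) → (+ 2) * z + - 1ℤ * y ≡ - x
    lemma x _ z refl = lemma′ x z
      where
      lemma′ : ∀ x z → (+ 2) * z + - 1ℤ * (x + (z + z)) ≡ - x
      lemma′ = solve-∀
    children : ∀ n → ⟦ Σsub f ⟧ n ≡ ⟦ f ⟧ n + (⟦ Σsub (𝟙 ⊗ f) ⟧ n + ⟦ Σsub (𝟙 ⊗ f) ⟧ n)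
    children n = trans (total-cong (trees n) (Σsub-children f))
      (trans (total-⊕ (trees n) f _)
      (cong (_+_ (⟦ f ⟧ n)) (trans (total-⊕ (trees n) (Σsub (f ⊗ 𝟙)) _)
                                (cong (_+ ⟦ Σsub (𝟙 ⊗ f) ⟧ n) (Σsub-≃ (⊗-swap f 𝟙) n)))))
    eq : ∀ n → ∣ ⟦ Σsub (+ 2 ⊙ (𝟙 ⊗ f) ⊕ - 1ℤ ⊙ f) ⟧ n ∣ ≡ ∣ ⟦ f ⟧ n ∣
    eq n = trans (cong ∣_∣ (trans (⟦Σsub⟧-⊕ (+ 2 ⊙ (𝟙 ⊗ f)) (- 1ℤ ⊙ f) n)
      (trans (cong₂ _+_ (⟦Σsub⟧-⊙ (+ 2) (𝟙 ⊗ f) n) (⟦Σsub⟧-⊙ (- 1ℤ) f n))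
             (lemma (⟦ f ⟧ n) (⟦ Σsub f ⟧ n) (⟦ Σsub (𝟙 ⊗ f) ⟧ n) (children n)))))
      (ℤ.∣-i∣≡∣i∣ (⟦ f ⟧ n))

  negligible-≗ : ∀ {f g} → (∀ t → f t ≡ g t) → Negligible f → Negligible g
  negligible-≗ p = negligible-≃ (≗⇒≃ p)

  ≃⇒negligible : ∀ {f g} → f ≃ g → Negligible (f ⊕ - 1ℤ ⊙ g)
  ≃⇒negligible {f} {g} f≃g = 0 , λ n → ℕ.≤-reflexive (cong ∣_∣ (begin
    ⟦ Σsub (f ⊕ - 1ℤ ⊙ g) ⟧ n                ≡⟨ ⟦Σsub⟧-⊕ f (- 1ℤ ⊙ g) n ⟩
    ⟦ Σsub f ⟧ n + ⟦ Σsub (- 1ℤ ⊙ g) ⟧ n     ≡⟨ cong₂ _+_ (Σsub-≃ f≃g n) (⟦Σsub⟧-⊙ (- 1ℤ) g n) ⟩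
    ⟦ Σsub g ⟧ n + - 1ℤ * ⟦ Σsub g ⟧ n       ≡⟨ cancel (⟦ Σsub g ⟧ n) ⟩
    0ℤ                                       ∎))
    where
    open ≡-Reasoning
    cancel : ∀ x → x + - 1ℤ * x ≡ 0ℤ
    cancel = solve-∀

  half′ : ∀ f → Bounded f → Negligible (+ 2 ⊙ (f ⊗ 𝟙) ⊕ - 1ℤ ⊙ f)
  half′ f b = negligible-≗ (λ t → lemma ((f ⊗ 𝟙) t) ((𝟙 ⊗ f) t) (f t))
    (half f b ⊞ + 2 ⊡ ≃⇒negligible (⊗-swap f 𝟙))
    where
    lemma : ∀ x y z → + 2 * y + - 1ℤ * z + + 2 * (x + - 1ℤ * y) ≡ + 2 * x + - 1ℤ * z
    lemma = solve-∀

  -- The state (c , h) of a tree t says that 4 c + h is the greatest length of a subsequence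
  -- of the permutation coded by t whose up/down sequence is a prefix of UUUDUUUD…

  State : Set
  State = ℕ × Fin 4

  infixl 6 _⊔_
  _⊔_ : ∀ {n} → Fin n → Fin n → Fin n
  Fin.zero  ⊔ j         = j
  Fin.suc i ⊔ Fin.zero  = Fin.suc i
  Fin.suc i ⊔ Fin.suc j = Fin.suc (i ⊔ j)

  -- After 4 c entries of the right subtree a fall is due, and all later entries are lower. So
  -- completed blocks add up. The phase reached on the right can matter only if no block is
  -- completed afterwards, and then the larger phase wins.
  join : State → State → State
  join (c , h) (zero  , h′) = c , h ⊔ h′
  join (c , h) (suc d , h′) = suc (c ℕ.+ d) , h′

  -- The root exceeds all entries of the left subtree, so it can only end an up step. It helps in
  -- every phase except 0 after a completed block, where a fall is due; in state (0 , 0) it starts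
  -- the subsequence.
  up : State → State
  up (c     , 1F) = c , 2F
  up (c     , 2F) = c , 3F
  up (c     , 3F) = suc c , 0F
  up (zero  , 0F) = 0 , 1F
  up (suc c , 0F) = suc c , 0F

  state : Tree → State
  state leaf       = 0 , 0F
  state (node r l) = join (state r) (up (state l))

  completions : Tree → ℕ
  completions t = proj₁ (state t)

  -- Classes of states, and identities between them checked by cases.

  𝟙[_≤_] : Fin 4 → Fin 4 → ℤ
  𝟙[ h ≤ k ] = if does (h Fin.≤? k) then 1ℤ else 0ℤ

  -- The phase of a node depends on the block counts of its children only through whether they are
  -- zero. Indicators that separate c = 0 from c > 0 therefore close the recursion.
  fresh reset : Fin 4 → State → ℤ
  fresh k (zero  , h) = 𝟙[ h ≤ k ]
  fresh k (suc _ , h) = 0ℤ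
  reset k (zero  , h) = 0ℤ
  reset k (suc _ , h) = 𝟙[ h ≤ k ]

  full : State → ℤ
  full (_ , h) = 𝟙[ 3F ≤ h ]

  Fresh Reset : Fin 4 → Tree → ℤ
  Fresh k = fresh k ∘ state
  Reset k = reset k ∘ state

  -- `ε` singles out `leaf`: `up` never returns (0 , 0), so no node has that state.
  ε Full : Tree → ℤ
  ε = Fresh 0F
  Full = full ∘ state

  -- Decides an identity on the 16 pairs of phases. Once c and d are each zero or a successor, the
  -- functions compared compute without knowing the predecessors, so the test evaluates and its
  -- proof can be left as `_`.
  Agree : (F G : State → State → ℤ) → ℕ → ℕ → Set
  Agree F G c d = True (Fin.all? λ h → Fin.all? λ k → F (c , h) (d , k) ℤ.≟ G (c , h) (d , k))

  by-cases : ∀ (F G : State → State → ℤ) → Agree F G 0 0 → (∀ d → Agree F G 0 (suc d)) →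
             (∀ c → Agree F G (suc c) 0) → (∀ c d → Agree F G (suc c) (suc d)) → ∀ s u → F s u ≡ G s u
  by-cases F G zz zs sz ss (zero  , h) (zero  , k) = toWitness zz h k
  by-cases F G zz zs sz ss (zero  , h) (suc d , k) = toWitness (zs d) h k
  by-cases F G zz zs sz ss (suc c , h) (zero  , k) = toWitness (sz c) h k
  by-cases F G zz zs sz ss (suc c , h) (suc d , k) = toWitness (ss c d) h k

  ε-node : ∀ r l → ε (node r l) ≡ 0ℤ
  ε-node r l = by-cases (λ s u → fresh 0F (join s (up u))) (λ _ _ → 0ℤ)
    _ _ _ _ (state r) (state l)

  -- The root lifts a nonempty left child to phase at least 2 or to a completed block, so the left
  -- child must be empty.
  Fresh₁-node : ∀ t → Fresh 1F t ≡ (ε ⊕ Fresh 1F ⊗ ε) t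
  Fresh₁-node leaf       = refl
  Fresh₁-node (node r l) = by-cases
    (λ s u → fresh 1F (join s (up u))) (λ s u → fresh 0F (join s (up u)) + fresh 1F s * fresh 0F u)
    _ _ _ _ (state r) (state l)

  -- The root adds 1 to the phase of the left child, which may therefore be at most 1.
  Fresh₂-node : ∀ t → Fresh 2F t ≡ (ε ⊕ Fresh 2F ⊗ Fresh 1F) t
  Fresh₂-node leaf       = refl
  Fresh₂-node (node r l) = by-cases
    (λ s u → fresh 2F (join s (up u))) (λ s u → fresh 0F (join s (up u)) + fresh 2F s * fresh 1F u)
    _ _ _ _ (state r) (state l)

  𝟙-node : ∀ t → 𝟙 t ≡ (ε ⊕ 𝟙 ⊗ 𝟙) t
  𝟙-node leaf       = refl
  𝟙-node (node r l) = sym (cong (_+ 1ℤ) (ε-node r l))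

  -- A left child in K is empty or has children in K′ and K″. Rotating the tree leaves K″ as the
  -- condition on the left child and hands `a` and K′ to the right one.
  ⊗-rotate : ∀ a {K K′ K″} → (∀ t → K t ≡ (ε ⊕ K′ ⊗ K″) t) → a ⊗ K ≃ a ⊗ ε ⊕ (a ⊗ K′) ⊗ K″
  ⊗-rotate a {K} {K′} {K″} eq n = begin
    ⟦ a ⊗ K ⟧ n                        ≡⟨ ≗⇒≃ (λ { leaf → refl ; (node r l) → cong (a r *_) (eq l) }) n ⟩
    ⟦ a ⊗ (ε ⊕ K′ ⊗ K″) ⟧ n            ≡⟨ ⊗-distribˡ a ε (K′ ⊗ K″) n ⟩
    ⟦ a ⊗ ε ⊕ a ⊗ (K′ ⊗ K″) ⟧ n        ≡⟨ ⊕-cong {a ⊗ ε} (λ _ → refl) (⊗-assoc a K′ K″) n ⟩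
    ⟦ a ⊗ ε ⊕ (a ⊗ K′) ⊗ K″ ⟧ n        ∎
    where open ≡-Reasoning

  𝟙-bounded : Bounded 𝟙
  𝟙-bounded = 1 , λ _ → s≤s z≤n

  𝟙≤-bounded : ∀ h k → ∣ 𝟙[ h ≤ k ] ∣ ℕ.≤ 1
  𝟙≤-bounded h k with does (h Fin.≤? k)
  ... | true  = s≤s z≤n
  ... | false = z≤n

  Fresh-bounded : ∀ k → Bounded (Fresh k)
  Fresh-bounded k = 1 , λ t → lemma (state t)
    where
    lemma : ∀ s → ∣ fresh k s ∣ ℕ.≤ 1
    lemma (zero  , h) = 𝟙≤-bounded h k
    lemma (suc _ , h) = z≤n

  Reset-bounded : ∀ k → Bounded (Reset k)
  Reset-bounded k = 1 , λ t → lemma (state t)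
    where
    lemma : ∀ s → ∣ reset k s ∣ ℕ.≤ 1
    lemma (zero  , h) = z≤n
    lemma (suc _ , h) = 𝟙≤-bounded h k

  Full-bounded : Bounded Full
  Full-bounded = 1 , λ t → 𝟙≤-bounded 3F (proj₂ (state t))

  -- For the multiplier x of ε, rotation with `𝟙-node` gives 1/2 = x + 1/4.
  quarter : ∀ a → Bounded a → Negligible (+ 4 ⊙ (a ⊗ ε) ⊕ - 1ℤ ⊙ a)
  quarter a b = negligible-≗ (λ t → lemma (a t) ((a ⊗ 𝟙) t) ((a ⊗ ε) t) (((a ⊗ 𝟙) ⊗ 𝟙) t))
    (- (+ 4) ⊡ ≃⇒negligible (⊗-rotate a 𝟙-node) ⊞ - (+ 2) ⊡ half′ (a ⊗ 𝟙) (⊗-bounded b 𝟙-bounded) ⊞ half′ a b)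
    where
    lemma : ∀ a t z s → - (+ 4) * (t + - 1ℤ * (z + s)) + - (+ 2) * (+ 2 * s + - 1ℤ * t) + (+ 2 * t + - 1ℤ * a)
                        ≡ + 4 * z + - 1ℤ * a
    lemma = solve-∀

  -- Rotation with `Fresh₁-node` gives x = 1/4 + x/4.
  third : ∀ a → Bounded a → Negligible (+ 3 ⊙ (a ⊗ Fresh 1F) ⊕ - 1ℤ ⊙ a)
  third a b = negligible-≗ (λ t → lemma (a t) ((a ⊗ Fresh 1F) t) ((a ⊗ ε) t) (((a ⊗ Fresh 1F) ⊗ ε) t))
    (+ 4 ⊡ ≃⇒negligible (⊗-rotate a Fresh₁-node) ⊞ quarter a b ⊞ quarter (a ⊗ Fresh 1F) (⊗-bounded b (Fresh-bounded 1F)))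
    where
    lemma : ∀ a b z y → + 4 * (b + - 1ℤ * (z + y)) + (+ 4 * z + - 1ℤ * a) + (+ 4 * y + - 1ℤ * b)
                        ≡ + 3 * b + - 1ℤ * a
    lemma = solve-∀

  -- Rotation with `Fresh₂-node` gives x = 1/4 + x/3.
  three-eighths : ∀ a → Bounded a → Negligible (+ 8 ⊙ (a ⊗ Fresh 2F) ⊕ - (+ 3) ⊙ a)
  three-eighths a b = negligible-≗ (λ t → lemma (a t) ((a ⊗ Fresh 2F) t) ((a ⊗ ε) t) (((a ⊗ Fresh 2F) ⊗ Fresh 1F) t))
    (+ 12 ⊡ ≃⇒negligible (⊗-rotate a Fresh₂-node) ⊞ + 3 ⊡ quarter a b ⊞ + 4 ⊡ third (a ⊗ Fresh 2F) (⊗-bounded b (Fresh-bounded 2F)))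
    where
    lemma : ∀ a b z y → + 12 * (b + - 1ℤ * (z + y)) + + 3 * (+ 4 * z + - 1ℤ * a) + + 4 * (+ 3 * y + - 1ℤ * b)
                        ≡ + 8 * b + - (+ 3) * a
    lemma = solve-∀

  -- A tree with n nodes has n + 1 leaves, hence 2 n + 1 subtrees.
  twice-leaves : Negligible (𝟙 ⊕ - (+ 2) ⊙ ε)
  twice-leaves = 1 , λ n → total-bounded (trees n) (λ t → ℕ.≤-reflexive (cong ∣_∣ (excess t)))
    where
    excess : ∀ t → Σsub (𝟙 ⊕ - (+ 2) ⊙ ε) t ≡ - 1ℤ
    excess leaf       = refl
    excess (node r l) rewrite ε-node r l | excess r | excess l = refl

  Σsub-ε : ∀ t → Σsub ε t ≡ + suc (size t)
  Σsub-ε leaf       = refl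
  Σsub-ε (node r l) rewrite ε-node r l | Σsub-ε r | Σsub-ε l =
    trans (ℤ.+-identityˡ _) (cong (+_ ∘ suc) (ℕ.+-suc (size r) (size l)))

  -- `join` adds the two block counts and `up` adds one exactly in phase 3, so the count is the sum
  -- of these increments.
  Σsub-full : ∀ t → Σsub (𝟙 ⊗ Full) t ≡ + completions t
  Σsub-full leaf       = refl
  Σsub-full (node r l) rewrite Σsub-full r | Σsub-full l =
    sym (trans (joined (state r) (up (state l)))
      (trans (cong (_+_ (+ completions r)) (upped (state l))) (comm (+ completions r) (+ completions l) (Full l))))
    where
    comm : ∀ a b c → a + (b + c) ≡ 1ℤ * c + (a + b)
    comm = solve-∀
    joined : ∀ s u → + proj₁ (join s u) ≡ + proj₁ s + + proj₁ u
    joined (c , h) (zero  , k) = cong +_ (sym (ℕ.+-identityʳ c))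
    joined (c , h) (suc d , k) = cong +_ (sym (ℕ.+-suc c d))
    upped : ∀ s → + proj₁ (up s) ≡ + proj₁ s + full s
    upped (zero  , 0F) = refl
    upped (suc c , 0F) = sym (ℤ.+-identityʳ _)
    upped (c     , 1F) = sym (ℤ.+-identityʳ _)
    upped (c     , 2F) = sym (ℤ.+-identityʳ _)
    upped (c     , 3F) = cong +_ (ℕ.+-comm 1 c)

  -- Phase exactly 1 or 2 after a completed block: the states with c > 0 in which a root raises the
  -- phase without completing a block.
  Reset₁ Reset₂ : Tree → ℤ
  Reset₁ = Reset 1F ⊕ - 1ℤ ⊙ Reset 0F
  Reset₂ = Reset 2F ⊕ - 1ℤ ⊙ Reset 1F

  -- The coefficients solve the linear system for the classes Reset k, Fresh 3F and Full; the resulting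
  -- identity at a node only involves the states of its two children.
  completed-eleventh : Negligible (+ 22 ⊙ (𝟙 ⊗ Full) ⊕ - (+ 2) ⊙ ε)
  completed-eleventh = negligible-≗ identity
    -- Per leaf and up to bounded errors, write F for `Full` and R0, ..., R3 for the `Reset`
    -- classes. Then R0 = (R0 + F)/2, R1 = R0 + R1/4, R2 = (R1 + F)/2 + R2/3, R3 = (R2 + F)/2 + 3
    -- R3/8, so R0 = F, R1 = 4F/3, R2 = 7F/4, R3 = 11F/5. `Fresh 3F` has x = 1 + 3x/8, that is 8/5,
    -- and with R3 makes up the 2 subtrees per leaf. So R3 = 2/5 and F = 2/11, which `half` turns
    -- into 1/11.
    (  + 11 ⊡ half Full Full-bounded
    ⊞ - (+ 11) ⊡ half (Reset 0F ⊕ Full) (⊕-bounded {Reset 0F} (Reset-bounded 0F) Full-bounded)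
    ⊞ + 5 ⊡ twice-leaves
    ⊞ - 1ℤ ⊡ three-eighths (Fresh 3F) (Fresh-bounded 3F)
    ⊞ - (+ 7) ⊡ half Reset₁ (⊕-bounded {Reset 1F} (Reset-bounded 1F) (⊙-bounded (- 1ℤ) {Reset 0F} (Reset-bounded 0F)))
    ⊞ - (+ 4) ⊡ half Reset₂ (⊕-bounded {Reset 2F} (Reset-bounded 2F) (⊙-bounded (- 1ℤ) {Reset 1F} (Reset-bounded 1F)))
    ⊞ - (+ 2) ⊡ third (Reset 2F) (Reset-bounded 2F)
    ⊞ - 1ℤ ⊡ quarter (Reset 1F) (Reset-bounded 1F)
    ⊞ - 1ℤ ⊡ three-eighths (Reset 3F) (Reset-bounded 3F))
    where
    identity : ∀ t → _
    identity leaf       = refl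
    -- All averaging has been done in the negligible summands; what is left holds at every single
    -- node.
    identity (node r l) = by-cases
      (λ s u → let v = join s (up u) in
          + 11 * (+ 2 * (1ℤ * full u) + - 1ℤ * full v)
        + - (+ 11) * (+ 2 * (1ℤ * (reset 0F u + full u)) + - 1ℤ * (reset 0F v + full v))
        + + 5 * (1ℤ + - (+ 2) * fresh 0F v)
        + - 1ℤ * (+ 8 * (fresh 3F s * fresh 2F u) + - (+ 3) * fresh 3F v)
        + - (+ 7) * (+ 2 * (1ℤ * (reset 1F u + - 1ℤ * reset 0F u)) + - 1ℤ * (reset 1F v + - 1ℤ * reset 0F v))
        + - (+ 4) * (+ 2 * (1ℤ * (reset 2F u + - 1ℤ * reset 1F u)) + - 1ℤ * (reset 2F v + - 1ℤ * reset 1F v))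
        + - (+ 2) * (+ 3 * (reset 2F s * fresh 1F u) + - 1ℤ * reset 2F v)
        + - 1ℤ * (+ 4 * (reset 1F s * fresh 0F u) + - 1ℤ * reset 1F v)
        + - 1ℤ * (+ 8 * (reset 3F s * fresh 2F u) + - (+ 3) * reset 3F v))
      (λ s u → + 22 * (1ℤ * full u) + - (+ 2) * fresh 0F (join s (up u)))
      _ _ _ _ (state r) (state l)

  total-completions : ∀ n ts → All (λ t → size t ≡ n) ts →
    total ts (Σsub (+ 22 ⊙ (𝟙 ⊗ Full) ⊕ - (+ 2) ⊙ ε))
      ≡ + 22 * + sum (map completions ts) + - (+ 2) * (+ suc n * + length ts)
  total-completions n []       []         = sym (cong (λ z → 0ℤ + - (+ 2) * z) (ℤ.*-zeroʳ (+ suc n)))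
  total-completions n (t ∷ ts) (refl ∷ p) = begin
    Σsub (+ 22 ⊙ (𝟙 ⊗ Full) ⊕ - (+ 2) ⊙ ε) t + total ts _
      ≡⟨ cong₂ _+_ (trans (Σsub-⊕ (+ 22 ⊙ (𝟙 ⊗ Full)) (- (+ 2) ⊙ ε) t)
                   (cong₂ _+_ (trans (Σsub-⊙ (+ 22) (𝟙 ⊗ Full) t) (cong (+ 22 *_) (Σsub-full t)))
                              (trans (Σsub-⊙ (- (+ 2)) ε t) (cong (- (+ 2) *_) (Σsub-ε t)))))
                   (total-completions n ts p) ⟩
    + 22 * + completions t + - (+ 2) * + suc n + (+ 22 * + c + - (+ 2) * (+ suc n * + length ts))
      ≡⟨ lemma (+ completions t) (+ suc n) (+ c) (+ length ts) ⟩
    + 22 * (+ completions t + + c) + - (+ 2) * (+ suc n * (1ℤ + + length ts))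
      ∎
    where
    open ≡-Reasoning
    c = sum (map completions ts)
    lemma : ∀ a n c l → + 22 * a + - (+ 2) * n + (+ 22 * c + - (+ 2) * (n * l)) ≡ + 22 * (a + c) + - (+ 2) * (n * (1ℤ + l))
    lemma = solve-∀

  -- The average of c is (n + 1)/11 up to a constant, with denominators cleared.
  CompletionsBound : ℕ → Set
  CompletionsBound K = ∀ n →
    ∣ + 22 * + sum (map completions (trees n)) + - (+ 2) * (+ suc n * + count n) ∣ ≤ K ℕ.* count n

  negligible⇒bound : Negligible (+ 22 ⊙ (𝟙 ⊗ Full) ⊕ - (+ 2) ⊙ ε) → ∃[ K ] CompletionsBound K
  negligible⇒bound (K , p) = K , λ n → subst (λ z → ∣ z ∣ ≤ K ℕ.* count n)
    (total-completions n (trees n) (All.tabulate (∈-treesWithin⇒size n n))) (p n)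

open Counting using (Tree; leaf; node; size; trees; count; State; state; up; join; _⊔_; completions; treesWithin-unique; ∈-trees; ∈-treesWithin⇒size; CompletionsBound; negligible⇒bound; completed-eleventh)

-- Bijection between 132-avoiding permutations and binary trees.

module Coding where

  open import Data.Empty using (⊥; ⊥-elim)
  open import Data.Fin as Fin using (Fin; toℕ)
  open import Data.Fin.Patterns using (0F; 1F; 2F)
  import Data.Fin.Properties as Fin
  open import Data.List.Base using (List; []; _∷_; [_]; _++_; map; length; lookup; initLast; _∷ʳ′_)
  import Data.List.Properties as List
  open import Data.List.Membership.Propositional using (_∈_)
  import Data.List.Membership.Propositional.Properties as ∈
  open import Data.List.Membership.Propositional.Properties.WithK using (unique∧set⇒bag)
  open import Data.List.Relation.Binary.BagAndSetEquality using (∼bag⇒↭)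
  open import Data.List.Relation.Binary.Permutation.Propositional using (_↭_)
  open import Data.List.Relation.Binary.Sublist.Propositional using (_⊆_; []; _∷_; _∷ʳ_; ⊆-refl; ⊆-trans; minimum; from∈; to∈)
  open import Data.List.Relation.Binary.Sublist.Propositional.Properties using (++⁺; All-resp-⊆; map⁺)
  open import Data.List.Relation.Unary.All as All using (All; []; _∷_)
  import Data.List.Relation.Unary.All.Properties as All
  open import Data.List.Relation.Unary.Any using (here)
  open import Data.List.Relation.Unary.AllPairs using ([]; _∷_)
  open import Data.List.Relation.Unary.Unique.Propositional using (Unique)
  import Data.List.Relation.Unary.Unique.Propositional.Properties as Unique
  open import Data.Nat as ℕ using (ℕ; zero; suc; z≤n; s≤s; _≤_; _<_; _+_)
  import Data.Nat.Properties as ℕ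
  open import Data.Product using (∃-syntax; _×_; _,_; proj₁; proj₂)
  open import Data.Vec as Vec using (Vec; []; _∷_)
  import Data.Vec.Properties as Vec
  import Data.Vec.Relation.Unary.All as Vec using (All; []; _∷_)
  import Data.Vec.Relation.Unary.AllPairs as VecPairs using ([]; _∷_)
  import Data.Vec.Relation.Unary.Unique.Propositional as Vec using (Unique)
  open import Function using (_∘_; mk⇔; Equivalence)
  open import Relation.Binary.PropositionalEquality using (_≡_; _≢_; refl; sym; trans; cong; cong₂; subst; module ≡-Reasoning)
  open import Relation.Binary.Definitions using (tri<; tri≈; tri>)
  open import Relation.Nullary using (contradiction; Dec)
  open import Relation.Nullary.Decidable using (_×-dec_)

  ⊆-++⁻ : ∀ {A : Set} {xs : List A} as {bs} → xs ⊆ as ++ bs →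
          ∃[ ys ] ∃[ zs ] xs ≡ ys ++ zs × ys ⊆ as × zs ⊆ bs
  ⊆-++⁻ []       s         = [] , _ , refl , [] , s
  ⊆-++⁻ (a ∷ as) (_ ∷ʳ s)  with ⊆-++⁻ as s
  ... | ys , zs , refl , s₁ , s₂ = ys , zs , refl , _ ∷ʳ s₁ , s₂
  ⊆-++⁻ (a ∷ as) (refl ∷ s) with ⊆-++⁻ as s
  ... | ys , zs , refl , s₁ , s₂ = a ∷ ys , zs , refl , refl ∷ s₁ , s₂

  ⊆-map⁻ : ∀ {A B : Set} (f : A → B) {ys} xs → ys ⊆ map f xs → ∃[ zs ] ys ≡ map f zs × zs ⊆ xs
  ⊆-map⁻ f []       []         = [] , refl , []
  ⊆-map⁻ f (x ∷ xs) (_ ∷ʳ s)   with ⊆-map⁻ f xs s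
  ... | zs , refl , s′ = zs , refl , x ∷ʳ s′
  ⊆-map⁻ f (x ∷ xs) (refl ∷ s) with ⊆-map⁻ f xs s
  ... | zs , refl , s′ = x ∷ zs , refl , refl ∷ s′

  unique-⊆ : ∀ {A : Set} {xs ys : List A} → xs ⊆ ys → Unique ys → Unique xs
  unique-⊆ []         []       = []
  unique-⊆ (_ ∷ʳ s)   (_ ∷ u)  = unique-⊆ s u
  unique-⊆ (refl ∷ s) (px ∷ u) = All-resp-⊆ s px ∷ unique-⊆ s u

  ++-split : ∀ {A : Set} (as cs : List A) {bs ds} → length as ≡ length cs → as ++ bs ≡ cs ++ ds → as ≡ cs × bs ≡ ds
  ++-split []       []       _ eq = refl , eq
  ++-split (a ∷ as) (c ∷ cs) l eq with refl , eq′ ← List.∷-injective eq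
    with refl , eq″ ← ++-split as cs (ℕ.suc-injective l) eq′ = refl , eq″

  lookup-injective : ∀ {A : Set} {xs : List A} → Unique xs → ∀ {i j} → lookup xs i ≡ lookup xs j → i ≡ j
  lookup-injective         (px ∷ u) {0F}        {0F}        eq = refl
  lookup-injective {xs = _ ∷ xs} (px ∷ u) {0F}  {Fin.suc j} eq = contradiction eq (All.lookup px (∈.∈-lookup {xs = xs} j))
  lookup-injective {xs = _ ∷ xs} (px ∷ u) {Fin.suc i} {0F}  eq = contradiction (sym eq) (All.lookup px (∈.∈-lookup {xs = xs} i))
  lookup-injective         (px ∷ u) {Fin.suc i} {Fin.suc j} eq = cong Fin.suc (lookup-injective u eq)

  Between : ℕ → ℕ → ℕ → Set
  Between lo n x = lo ≤ x × x < lo + n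

  -- Pigeonhole: subtracting `lo` from the entries embeds the positions into `Fin n`.
  unique-length≤ : ∀ {lo n xs} → Unique xs → All (Between lo n) xs → length xs ≤ n
  unique-length≤ {lo} {n} {xs} u bs = Fin.injective⇒≤ {f = position} injective
    where
    between : ∀ i → Between lo n (lookup xs i)
    between i = All.lookup bs (∈.∈-lookup {xs = xs} i)
    offset< : ∀ i → lookup xs i ℕ.∸ lo < n
    offset< i = ℕ.+-cancelˡ-< lo _ _
      (subst (_< lo + n) (sym (ℕ.m+[n∸m]≡n (proj₁ (between i)))) (proj₂ (between i)))
    position : Fin (length xs) → Fin n
    position i = Fin.fromℕ< (offset< i)
    injective : ∀ {i j} → position i ≡ position j → i ≡ j
    injective {i} {j} eq = lookup-injective u
      (ℕ.∸-cancelʳ-≡ (proj₁ (between i)) (proj₁ (between j)) (Fin.fromℕ<-injective _ _ (offset< i) (offset< j) eq))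

  -- A 132-avoiding sequence with last entry k consists of its entries above k, then those below k, then k.
  code : ℕ → Tree → List ℕ
  code lo leaf       = []
  code lo (node r l) = code (suc (lo + size l)) r ++ (code lo l ++ [ lo + size l ])

  length-code : ∀ lo t → length (code lo t) ≡ size t
  length-code lo leaf       = refl
  length-code lo (node r l) = begin
    length (code (suc (lo + size l)) r ++ (code lo l ++ [ lo + size l ]))          ≡⟨ List.length-++ (code _ r) ⟩
    length (code (suc (lo + size l)) r) + length (code lo l ++ [ lo + size l ])    ≡⟨ cong₂ _+_ (length-code _ r) (List.length-++ (code lo l)) ⟩
    size r + (length (code lo l) + 1)                                              ≡⟨ cong (λ m → size r + (m + 1)) (length-code lo l) ⟩
    size r + (size l + 1)                                                          ≡⟨ cong (size r +_) (ℕ.+-comm (size l) 1) ⟩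
    size r + suc (size l)                                                          ≡⟨ ℕ.+-suc (size r) (size l) ⟩
    suc (size r + size l)                                                          ∎
    where open ≡-Reasoning

  code-between : ∀ lo t → All (Between lo (size t)) (code lo t)
  code-between lo leaf       = []
  code-between lo (node r l) = All.++⁺
    (All.map (λ (p , q) → ℕ.≤-trans (ℕ.m≤n⇒m≤1+n (ℕ.m≤m+n lo (size l))) p , ℕ.<-≤-trans q high) (code-between _ r))
    (All.++⁺ (All.map (λ (p , q) → p , ℕ.<-trans q top) (code-between lo l)) ((ℕ.m≤m+n lo (size l) , top) ∷ []))
    where
    high : suc (lo + size l) + size r ≤ lo + suc (size r + size l)
    high = ℕ.≤-reflexive (trans (cong suc (trans (ℕ.+-assoc lo (size l) (size r)) (cong (lo +_) (ℕ.+-comm (size l) (size r)))))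
                                (sym (ℕ.+-suc lo _)))
    top : lo + size l < lo + suc (size r + size l)
    top = ℕ.+-monoʳ-< lo (s≤s (ℕ.m≤n+m (size l) (size r)))

  code-above : ∀ lo r l → All (lo + size l <_) (code (suc (lo + size l)) r)
  code-above lo r l = All.map proj₁ (code-between _ r)

  code-below : ∀ lo l → All (_< lo + size l) (code lo l)
  code-below lo l = All.map proj₂ (code-between lo l)

  code-tree-below : ∀ lo l → All (_≤ lo + size l) (code lo l ++ [ lo + size l ])
  code-tree-below lo l = All.++⁺ (All.map ℕ.<⇒≤ (code-below lo l)) (ℕ.≤-refl ∷ [])

  code-unique : ∀ lo t → Unique (code lo t)
  code-unique lo leaf       = []
  code-unique lo (node r l) = Unique.++⁺ (code-unique _ r)
    (Unique.++⁺ (code-unique lo l) ([] ∷ []) λ { (p , here refl) → ℕ.<-irrefl refl (All.lookup (code-below lo l) p) })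
    λ (p , q) → ℕ.<⇒≱ (All.lookup (code-above lo r l) p) (All.lookup (code-tree-below lo l) q)

  -- The last entry reveals the size of the left subtree, and the total length then that of the
  -- right one, so both codes are cut at the same places.
  code-injective : ∀ lo t u → code lo t ≡ code lo u → t ≡ u
  code-injective lo leaf leaf eq = refl
  code-injective lo leaf (node r l) eq with () ← trans (cong length eq) (length-code lo (node r l))
  code-injective lo (node r l) leaf eq with () ← trans (sym (cong length eq)) (length-code lo (node r l))
  code-injective lo (node r l) (node r′ l′) eq = cong₂ node (code-injective _ r r′ eqʳ) (code-injective lo l l′ eqˡ)
    where
    R  = code (suc (lo + size l)) r
    R′ = code (suc (lo + size l′)) r′
    L₀ = code lo l
    L′ = code lo l′
    unsnoc : R ++ L₀ ≡ R′ ++ L′ × lo + size l ≡ lo + size l′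
    unsnoc = List.∷ʳ-injective (R ++ L₀) (R′ ++ L′)
      (trans (List.++-assoc R L₀ _) (trans eq (sym (List.++-assoc R′ L′ _))))
    sizesˡ : size l ≡ size l′
    sizesˡ = ℕ.+-cancelˡ-≡ lo _ _ (proj₂ unsnoc)
    sizesʳ : size r ≡ size r′
    sizesʳ = ℕ.+-cancelʳ-≡ (size l) _ _ (ℕ.suc-injective
      (trans (sym (length-code lo (node r l))) (trans (cong length eq)
        (trans (length-code lo (node r′ l′)) (cong (λ m → suc (size r′ + m)) (sym sizesˡ))))))
    parts : R ≡ R′ × L₀ ≡ L′
    parts = ++-split R R′ (trans (length-code _ r) (trans sizesʳ (sym (length-code _ r′)))) (proj₁ unsnoc)
    eqʳ : code (suc (lo + size l)) r ≡ code (suc (lo + size l)) r′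
    eqʳ = trans (proj₁ parts) (cong (λ m → code (suc (lo + m)) r′) (sym sizesˡ))
    eqˡ : L₀ ≡ L′
    eqˡ = proj₂ parts

  -- Phrased with sublists of numbers, it passes to the parts of a `code` without renumbering.
  Avoiding : List ℕ → Set
  Avoiding xs = ∀ {x y z} → x ∷ y ∷ z ∷ [] ⊆ xs → x < z → z < y → ⊥

  avoiding-⊆ : ∀ {xs ys} → xs ⊆ ys → Avoiding ys → Avoiding xs
  avoiding-⊆ s av t = av (⊆-trans t s)

  ∈-⊆ : ∀ {A : Set} {x : A} {xs ys} → x ∷ xs ⊆ ys → x ∈ ys
  ∈-⊆ s = to∈ (⊆-trans (refl ∷ minimum _) s)

  -- Entries of the high part exceed everything after that part, so x in it forces y and z into it.
  -- If x and y lie in the low part, z is not the root, which would exceed y.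
  avoiding-code : ∀ lo t → Avoiding (code lo t)
  avoiding-code lo leaf       ()
  avoiding-code lo (node r l) s x<z z<y with ⊆-++⁻ (code (suc (lo + size l)) r) s
  ... | _ ∷ _ ∷ _ ∷ [] , [] , refl , s₁ , _ = avoiding-code _ r s₁ x<z z<y
  ... | _ ∷ _ ∷ []     , _ ∷ [] , refl , s₁ , s₂ =
    ℕ.<⇒≱ (ℕ.<-trans (All.lookup (code-above lo r l) (∈-⊆ s₁)) x<z) (All.lookup (code-tree-below lo l) (∈-⊆ s₂))
  ... | _ ∷ []         , _ ∷ _ ∷ [] , refl , s₁ , s₂ =
    ℕ.<⇒≱ (ℕ.<-trans (All.lookup (code-above lo r l) (∈-⊆ s₁)) x<z) (All.lookup (code-tree-below lo l) (to∈ (⊆-trans (_ ∷ʳ ⊆-refl) s₂)))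
  ... | []             , _ , refl , _ , s₂ with ⊆-++⁻ (code lo l) s₂
  ...   | _ ∷ _ ∷ _ ∷ [] , [] , refl , s₃ , _ = avoiding-code lo l s₃ x<z z<y
  ...   | _ ∷ _ ∷ [] , _ ∷ [] , refl , s₃ , refl ∷ [] =
    ℕ.<-asym z<y (All.lookup (code-below lo l) (to∈ (⊆-trans (_ ∷ʳ ⊆-refl) s₃)))
  ...   | [] , _ , refl , _ , _ ∷ʳ ()
  ...   | _ ∷ [] , _ ∷ _ ∷ [] , refl , _ , refl ∷ ()
  ...   | _ ∷ _ ∷ _ ∷ _ ∷ _ , _ , () , _

  -- Once an entry below k has appeared, no later one lies above k: followed by k, the two would
  -- form the pattern 132.
  separate : ∀ k ys → All (_≢ k) ys → (∀ {a b} → a ∷ b ∷ [] ⊆ ys → a < k → k < b → ⊥) →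
             ∃[ hs ] ∃[ ls ] ys ≡ hs ++ ls × All (k <_) hs × All (_< k) ls
  separate k []       ne av = [] , [] , refl , [] , []
  separate k (y ∷ ys) (y≢k ∷ ne) av with ℕ.<-cmp y k
  ... | tri≈ _ y≡k _ = contradiction y≡k y≢k
  ... | tri> _ _ k<y with separate k ys ne (λ s → av (y ∷ʳ s))
  ...   | hs , ls , refl , k<hs , ls<k = y ∷ hs , ls , refl , k<y ∷ k<hs , ls<k
  separate k (y ∷ ys) (y≢k ∷ ne) av | tri< y<k _ _ = [] , y ∷ ys , refl , [] , y<k ∷ All.tabulate below
    where
    below : ∀ {b} → b ∈ ys → b < k
    below b∈ with ℕ.<-cmp _ k
    ... | tri< b<k _ _ = b<k
    ... | tri≈ _ b≡k _ = contradiction b≡k (All.lookup ne b∈)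
    ... | tri> _ _ k<b = contradiction k<b (av (refl ∷ from∈ b∈) y<k)

  -- Without the last entry k, the list is a high part followed by a low part. That each of them
  -- fills its interval of values is forced by counting: neither can be longer than its interval,
  -- and the lengths add up to the total.
  decode : ∀ fuel lo xs → length xs ≤ fuel → Unique xs → All (Between lo (length xs)) xs → Avoiding xs →
           ∃[ t ] code lo t ≡ xs
  decode fuel lo xs len u bs av with initLast xs
  decode fuel lo .[] len u bs av | [] = leaf , refl
  decode zero lo .(ys ++ [ k ]) len u bs av | ys ∷ʳ′ k =
    contradiction (ℕ.≤-trans (ℕ.≤-reflexive (trans (ℕ.+-comm 1 (length ys)) (sym (List.length-++ ys)))) len) λ ()
  decode (suc fuel) lo .(ys ++ [ k ]) len u bs av | ys ∷ʳ′ k = result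
    where
    snoc : length (ys ++ [ k ]) ≡ suc (length ys)
    snoc = trans (List.length-++ ys) (ℕ.+-comm (length ys) 1)
    ys⊆ : ys ⊆ ys ++ [ k ]
    ys⊆ = subst (_⊆ ys ++ [ k ]) (List.++-identityʳ ys) (++⁺ (⊆-refl {x = ys}) (minimum [ k ]))
    parts : ∃[ hs ] ∃[ ls ] ys ≡ hs ++ ls × All (k <_) hs × All (_< k) ls
    parts = separate k ys
      (All.tabulate λ b∈ → λ { refl → contradiction refl (All.head (head′ (unique-⊆ (++⁺ (from∈ b∈) (⊆-refl {x = [ k ]})) u))) })
      (λ s a<k k<b → av (++⁺ s (⊆-refl {x = [ k ]})) a<k k<b)
      where
      head′ : ∀ {x : ℕ} {xs} → Unique (x ∷ xs) → All (x ≢_) xs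
      head′ (p ∷ _) = p
    k-between : Between lo (suc (length ys)) k
    k-between = subst (λ m → Between lo m k) snoc (All.head (All.++⁻ʳ ys bs))
    result : ∃[ t ] code lo t ≡ ys ++ [ k ]
    result with parts | k ℕ.∸ lo | ℕ.m+[n∸m]≡n (proj₁ k-between)
    -- Matching on the equation replaces k by lo + p, so p has to be the size of the left subtree.
    ... | hs , ls , eq , k<hs , ls<k | p | refl = node (proj₁ right) (proj₁ left) , coded
      where
      n = length ys
      p≤n : p ≤ n
      p≤n = ℕ.s≤s⁻¹ (ℕ.+-cancelˡ-< lo _ _ (proj₂ k-between))
      lengths : length hs + length ls ≡ n
      lengths = trans (sym (List.length-++ hs)) (cong length (sym eq))
      ls⊆ : ls ⊆ ys
      ls⊆ = subst (ls ⊆_) (sym eq) (++⁺ (minimum hs) (⊆-refl {x = ls}))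
      hs⊆ : hs ⊆ ys
      hs⊆ = subst (hs ⊆_) (sym eq) (subst (_⊆ hs ++ ls) (List.++-identityʳ hs) (++⁺ (⊆-refl {x = hs}) (minimum ls)))
      ys-between : All (Between lo (suc n)) ys
      ys-between = subst (λ m → All (Between lo m) ys) snoc (All-resp-⊆ ys⊆ bs)
      ls-between : All (Between lo p) ls
      ls-between = All.map (λ (b , l<k) → proj₁ b , l<k) (All.zip (All-resp-⊆ ls⊆ ys-between , ls<k))
      top : suc (lo + p) + (n ℕ.∸ p) ≡ lo + suc n
      top = trans (cong suc (trans (ℕ.+-assoc lo p _) (cong (lo +_) (ℕ.m+[n∸m]≡n p≤n)))) (sym (ℕ.+-suc lo n))
      hs-between : All (Between (suc (lo + p)) (n ℕ.∸ p)) hs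
      hs-between = All.map (λ (b , k<h) → k<h , ℕ.<-≤-trans (proj₂ b) (ℕ.≤-reflexive (sym top)))
                           (All.zip (All-resp-⊆ hs⊆ ys-between , k<hs))
      unique-ys = unique-⊆ ys⊆ u
      ls≤ : length ls ≤ p
      ls≤ = unique-length≤ (unique-⊆ ls⊆ unique-ys) ls-between
      hs≤ : length hs ≤ n ℕ.∸ p
      hs≤ = unique-length≤ (unique-⊆ hs⊆ unique-ys) hs-between
      p≤ : p ≤ length ls
      p≤ = ℕ.+-cancelˡ-≤ (n ℕ.∸ p) _ _ (begin
        n ℕ.∸ p + p              ≡⟨ ℕ.m∸n+n≡m p≤n ⟩
        n                        ≡⟨ lengths ⟨
        length hs + length ls    ≤⟨ ℕ.+-monoˡ-≤ (length ls) hs≤ ⟩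
        n ℕ.∸ p + length ls      ∎)
        where open ℕ.≤-Reasoning
      |ls| : length ls ≡ p
      |ls| = ℕ.≤-antisym ls≤ p≤
      |hs| : length hs ≡ n ℕ.∸ p
      |hs| = trans (sym (ℕ.m+n∸n≡m (length hs) (length ls))) (cong₂ ℕ._∸_ lengths |ls|)
      n≤fuel : n ≤ fuel
      n≤fuel = ℕ.s≤s⁻¹ (subst (_≤ suc fuel) snoc len)
      left : ∃[ l ] code lo l ≡ ls
      left = decode fuel lo ls (ℕ.≤-trans ls≤ (ℕ.≤-trans p≤n n≤fuel)) (unique-⊆ ls⊆ unique-ys)
        (subst (λ m → All (Between lo m) ls) (sym |ls|) ls-between) (avoiding-⊆ (⊆-trans ls⊆ ys⊆) av)
      right : ∃[ r ] code (suc (lo + p)) r ≡ hs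
      right = decode fuel (suc (lo + p)) hs (ℕ.≤-trans hs≤ (ℕ.≤-trans (ℕ.m∸n≤m n p) n≤fuel)) (unique-⊆ hs⊆ unique-ys)
        (subst (λ m → All (Between _ m) hs) (sym |hs|) hs-between) (avoiding-⊆ (⊆-trans hs⊆ ys⊆) av)
      size-left : size (proj₁ left) ≡ p
      size-left = trans (sym (length-code lo (proj₁ left))) (trans (cong length (proj₂ left)) |ls|)
      coded : code lo (node (proj₁ right) (proj₁ left)) ≡ ys ++ [ lo + p ]
      coded rewrite size-left | proj₂ left | proj₂ right | eq = sym (List.++-assoc hs ls _)

  -- Words as lists of numbers.

  values : ∀ {m n} → Word m n → List ℕ
  values σ = map toℕ (Vec.toList σ)

  length-values : ∀ {m n} (σ : Word m n) → length (values σ) ≡ n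
  length-values σ = trans (List.length-map toℕ (Vec.toList σ)) (Vec.length-toList σ)

  values-injective : ∀ {m n} (σ τ : Word m n) → values σ ≡ values τ → σ ≡ τ
  values-injective []      []      eq = refl
  values-injective (x ∷ σ) (y ∷ τ) eq =
    cong₂ _∷_ (Fin.toℕ-injective (List.∷-injectiveˡ eq)) (values-injective σ τ (List.∷-injectiveʳ eq))

  values-surjective : ∀ m xs → All (_< m) xs → ∃[ σ ] values {m} {length xs} σ ≡ xs
  values-surjective m []       []       = [] , refl
  values-surjective m (x ∷ xs) (p ∷ ps) with values-surjective m xs ps
  ... | σ , eq = Fin.fromℕ< p ∷ σ , cong₂ _∷_ (Fin.toℕ-fromℕ< p) eq

  values-bounded : ∀ {m n} (σ : Word m n) → All (_< m) (values σ)
  values-bounded []      = []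
  values-bounded (x ∷ σ) = Fin.toℕ<n x ∷ values-bounded σ

  all-values⁺ : ∀ {m n} (x : Fin m) {σ : Word m n} → Vec.All (x ≢_) σ → All (toℕ x ≢_) (values σ)
  all-values⁺ x Vec.[]       = []
  all-values⁺ x (p Vec.∷ ps) = (p ∘ Fin.toℕ-injective) ∷ all-values⁺ x ps

  all-values⁻ : ∀ {m n} (x : Fin m) (σ : Word m n) → All (toℕ x ≢_) (values σ) → Vec.All (x ≢_) σ
  all-values⁻ x []      []       = Vec.[]
  all-values⁻ x (y ∷ σ) (p ∷ ps) = (p ∘ cong toℕ) Vec.∷ all-values⁻ x σ ps

  unique-values⁺ : ∀ {m n} {σ : Word m n} → Vec.Unique σ → Unique (values σ)
  unique-values⁺ VecPairs.[]       = []
  unique-values⁺ (p VecPairs.∷ ps) = all-values⁺ _ p ∷ unique-values⁺ ps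

  unique-values⁻ : ∀ {m n} (σ : Word m n) → Unique (values σ) → Vec.Unique σ
  unique-values⁻ []      []       = VecPairs.[]
  unique-values⁻ (x ∷ σ) (p ∷ ps) = all-values⁻ x σ p VecPairs.∷ unique-values⁻ σ ps

  lookup₁ : ∀ {A : Set} {n} (v : Vec A n) i → Vec.lookup v i ∷ [] ⊆ Vec.toList v
  lookup₁ (x ∷ v) 0F          = refl ∷ minimum _
  lookup₁ (x ∷ v) (Fin.suc i) = x ∷ʳ lookup₁ v i

  lookup₂ : ∀ {A : Set} {n} (v : Vec A n) {i j} → i Fin.< j → Vec.lookup v i ∷ Vec.lookup v j ∷ [] ⊆ Vec.toList v
  lookup₂ (x ∷ v) {0F}        {Fin.suc j} _         = refl ∷ lookup₁ v j
  lookup₂ (x ∷ v) {Fin.suc i} {Fin.suc j} (s≤s i<j) = x ∷ʳ lookup₂ v i<j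

  lookup₃ : ∀ {A : Set} {n} (v : Vec A n) {i j k} → i Fin.< j → j Fin.< k →
            Vec.lookup v i ∷ Vec.lookup v j ∷ Vec.lookup v k ∷ [] ⊆ Vec.toList v
  lookup₃ (x ∷ v) {0F}        {Fin.suc j} {Fin.suc k} _         (s≤s j<k) = refl ∷ lookup₂ v j<k
  lookup₃ (x ∷ v) {Fin.suc i} {Fin.suc j} {Fin.suc k} (s≤s i<j) (s≤s j<k) = x ∷ʳ lookup₃ v i<j j<k

  index₁ : ∀ {A : Set} {n} (v : Vec A n) {x} → x ∷ [] ⊆ Vec.toList v → ∃[ i ] Vec.lookup v i ≡ x
  index₁ (_ ∷ v) (_ ∷ʳ s)   with i , eq ← index₁ v s = Fin.suc i , eq
  index₁ (_ ∷ v) (refl ∷ _) = 0F , refl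

  index₂ : ∀ {A : Set} {n} (v : Vec A n) {x y} → x ∷ y ∷ [] ⊆ Vec.toList v →
           ∃[ i ] ∃[ j ] i Fin.< j × Vec.lookup v i ≡ x × Vec.lookup v j ≡ y
  index₂ (_ ∷ v) (_ ∷ʳ s)   with i , j , i<j , eq , eq′ ← index₂ v s = Fin.suc i , Fin.suc j , s≤s i<j , eq , eq′
  index₂ (_ ∷ v) (refl ∷ s) with j , eq ← index₁ v s = 0F , Fin.suc j , s≤s z≤n , refl , eq

  index₃ : ∀ {A : Set} {n} (v : Vec A n) {x y z} → x ∷ y ∷ z ∷ [] ⊆ Vec.toList v →
           ∃[ i ] ∃[ j ] ∃[ k ] i Fin.< j × j Fin.< k × Vec.lookup v i ≡ x × Vec.lookup v j ≡ y × Vec.lookup v k ≡ z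
  index₃ (_ ∷ v) (_ ∷ʳ s)   with i , j , k , i<j , j<k , eqs ← index₃ v s =
    Fin.suc i , Fin.suc j , Fin.suc k , s≤s i<j , s≤s j<k , eqs
  index₃ (_ ∷ v) (refl ∷ s) with j , k , j<k , eqs ← index₂ v s =
    0F , Fin.suc j , Fin.suc k , s≤s z≤n , s≤s j<k , refl , eqs

  sameOrder-132 : ∀ {m} {x y z : Fin m} → x Fin.< z → z Fin.< y → SameOrder [132] (x ∷ y ∷ z ∷ [])
  sameOrder-132 {x = x} {y} {z} x<z z<y = λ where
      0F 0F → mk⇔ (λ ()) (λ p → ⊥-elim (ℕ.<-irrefl refl p))
      0F 1F → mk⇔ (λ _ → ℕ.<-trans x<z z<y) (λ _ → s≤s z≤n)
      0F 2F → mk⇔ (λ _ → x<z) (λ _ → s≤s z≤n)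
      1F 0F → mk⇔ (λ ()) (λ p → ⊥-elim (ℕ.<-asym p (ℕ.<-trans x<z z<y)))
      1F 1F → mk⇔ (λ { (s≤s (s≤s ())) }) (λ p → ⊥-elim (ℕ.<-irrefl refl p))
      1F 2F → mk⇔ (λ { (s≤s ()) }) (λ p → ⊥-elim (ℕ.<-asym p z<y))
      2F 0F → mk⇔ (λ ()) (λ p → ⊥-elim (ℕ.<-asym p x<z))
      2F 1F → mk⇔ (λ _ → z<y) (λ _ → s≤s (s≤s z≤n))
      2F 2F → mk⇔ (λ { (s≤s ()) }) (λ p → ⊥-elim (ℕ.<-irrefl refl p))

  avoids⇒avoiding : ∀ {n} (σ : Word n n) → Avoids [132] σ → Avoiding (values σ)
  avoids⇒avoiding σ av s x<z z<y with ⊆-map⁻ toℕ (Vec.toList σ) s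
  ... | _ ∷ _ ∷ _ ∷ [] , refl , s′ with i , j , k , i<j , j<k , refl , refl , refl ← index₃ σ s′ =
    av (i , j , k , i<j , j<k , sameOrder-132 x<z z<y)

  avoiding⇒avoids : ∀ {n} (σ : Word n n) → Avoiding (values σ) → Avoids [132] σ
  avoiding⇒avoids σ av (i , j , k , i<j , j<k , same) =
    av (map⁺ toℕ (lookup₃ σ i<j j<k)) (Equivalence.to (same 0F 2F) (s≤s z≤n)) (Equivalence.to (same 2F 1F) (s≤s (s≤s z≤n)))

  words-complete : ∀ {m n} (σ : Word m n) → σ ∈ words m n
  words-complete []      = here refl
  words-complete (x ∷ σ) = ∈.∈-cartesianProductWith⁺ _∷_ (∈.∈-allFin x) (words-complete σ)

  words-unique : ∀ m n → Unique (words m n)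
  words-unique m zero    = [] ∷ []
  words-unique m (suc n) = Unique.cartesianProductWith⁺ _∷_ Vec.∷-injective (Unique.allFin⁺ m) (words-unique m n)

  valid? : ∀ {n} (σ : Word n n) → Dec (IsPermutation σ × Avoids [132] σ)
  valid? σ = isPermutation? σ ×-dec avoids? [132] σ

  -- Both lists are free of duplicates, so equality of their sets of members suffices; `decode`
  -- gives one inclusion, `code-unique` and `avoiding-code` the other.
  S↭trees : ∀ n → map values (S n [132]) ↭ map (code 0) (trees n)
  S↭trees n = ∼bag⇒↭ (unique∧set⇒bag
    (Unique.map⁺ (values-injective _ _) (Unique.filter⁺ valid? (words-unique n n)))
    (Unique.map⁺ (code-injective 0 _ _) (treesWithin-unique n n))
    (mk⇔ to from))
    where
    to : ∀ {xs} → xs ∈ map values (S n [132]) → xs ∈ map (code 0) (trees n)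
    to xs∈ with σ , σ∈ , refl ← ∈.∈-map⁻ values xs∈
           with _ , perm , av ← ∈.∈-filter⁻ valid? {xs = words n n} σ∈
           with t , eq ← decode n 0 (values σ) (ℕ.≤-reflexive (length-values σ)) (unique-values⁺ perm)
                  (subst (λ m → All (Between 0 m) (values σ)) (sym (length-values σ)) (All.map (z≤n ,_) (values-bounded σ)))
                  (avoids⇒avoiding σ av) =
      subst (_∈ map (code 0) (trees n)) eq (∈.∈-map⁺ (code 0) (subst (λ m → t ∈ trees m) size-t (∈-trees t)))
      where
      size-t : size t ≡ n
      size-t = trans (sym (length-code 0 t)) (trans (cong length eq) (length-values σ))
    from : ∀ {xs} → xs ∈ map (code 0) (trees n) → xs ∈ map values (S n [132])
    from xs∈ with t , t∈ , refl ← ∈.∈-map⁻ (code 0) xs∈ with refl ← ∈-treesWithin⇒size n n t∈ =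
      subst (_∈ map values (S n [132])) (proj₂ word) (∈.∈-map⁺ values
        (∈.∈-filter⁺ valid? (words-complete (proj₁ word))
          (unique-values⁻ _ (subst Unique (sym (proj₂ word)) (code-unique 0 t)) ,
           avoiding⇒avoids _ (subst Avoiding (sym (proj₂ word)) (avoiding-code 0 t)))))
      where
      word : ∃[ σ ] values {size t} {size t} σ ≡ code 0 t
      word = subst (λ m → ∃[ σ ] values {size t} {m} σ ≡ code 0 t) (length-code 0 t)
               (values-surjective (size t) (code 0 t) (All.map proj₂ (code-between 0 t)))

open Coding

-- Longest subsequences following UUUDUUUD..., and their relation to `L`.

module Longest where

  open import Data.Bool using (if_then_else_; true; false)
  open import Data.Fin as Fin using (Fin; toℕ)
  open import Data.Fin.Patterns using (0F; 1F; 2F; 3F)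
  import Data.Fin.Properties as Fin
  open import Data.List.Base using (List; []; _∷_; [_]; _++_; map; length; take; replicate; concat)
  import Data.List.Properties as List
  import Data.List.Extrema.Nat as Extrema
  open import Data.List.Membership.Propositional using (_∈_)
  import Data.List.Membership.Propositional.Properties as ∈
  open import Data.List.Relation.Binary.Sublist.Propositional using (_⊆_; []; _∷_; _∷ʳ_; ⊆-refl; ⊆-trans; minimum)
  open import Data.List.Relation.Binary.Sublist.Propositional.Properties using (++⁺; All-resp-⊆; map⁺; take-⊆)
  open import Data.List.Relation.Unary.All as All using (All; []; _∷_)
  import Data.List.Relation.Unary.All.Properties as All
  open import Data.List.Relation.Unary.Any as Any using (here)
  open import Data.Nat as ℕ using (ℕ; zero; suc; z≤n; s≤s; _≤_; _<_; _+_; _*_)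
  open import Data.Nat.DivMod using (_divMod_; result)
  import Data.Nat.Properties as ℕ
  open import Data.Product using (∃-syntax; _×_; _,_; proj₁; proj₂)
  open import Data.Sum using (_⊎_; inj₁; inj₂)
  open import Data.Unit using (⊤)
  open import Data.Vec as Vec using (Vec; []; _∷_)
  open import Relation.Binary.PropositionalEquality using (_≡_; _≢_; refl; sym; trans; cong; cong₂; subst; module ≡-Reasoning)
  open import Relation.Nullary using (ofʸ; ofⁿ; ¬_; contradiction; does)

  -- The phase of a step is its position in the pattern UUUD.

  next : Fin 4 → Fin 4
  next 0F = 1F
  next 1F = 2F
  next 2F = 3F
  next 3F = 0F

  advance : Fin 4 → ℕ → Fin 4
  advance i zero    = i
  advance i (suc n) = advance (next i) n

  -- A fall is the failure of <, which is how `upDown` reads D.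
  Moves : Fin 4 → ℕ → ℕ → Set
  Moves 3F x y = ¬ x < y
  Moves _  x y = x < y

  Path : Fin 4 → ℕ → List ℕ → Set
  Path i x []       = ⊤
  Path i x (y ∷ ys) = Moves i x y × Path (next i) y ys

  -- The up/down sequence is a prefix of UUUDUUUD...; unlike whole repetitions, such lists may be
  -- truncated anywhere, which the recursion requires.
  Good : List ℕ → Set
  Good []       = ⊤
  Good (x ∷ xs) = Path 0F x xs

  last : ℕ → List ℕ → ℕ
  last x []       = x
  last x (y ∷ ys) = last y ys

  last-all : ∀ {P : ℕ → Set} {x xs} → All P (x ∷ xs) → P (last x xs)
  last-all {xs = []}    (p ∷ []) = p
  last-all {xs = _ ∷ _} (_ ∷ ps) = last-all ps

  path-++⁺ : ∀ i x ys {zs} → Path i x ys → Path (advance i (length ys)) (last x ys) zs → Path i x (ys ++ zs)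
  path-++⁺ i x []       _       q = q
  path-++⁺ i x (y ∷ ys) (m , p) q = m , path-++⁺ (next i) y ys p q

  path-++⁻ : ∀ i x ys {zs} → Path i x (ys ++ zs) → Path i x ys × Path (advance i (length ys)) (last x ys) zs
  path-++⁻ i x []       p       = _ , p
  path-++⁻ i x (y ∷ ys) (m , p) with path-++⁻ (next i) y ys p
  ... | p₁ , p₂ = (m , p₁) , p₂

  good-++ˡ : ∀ xs {ys} → Good (xs ++ ys) → Good xs
  good-++ˡ []       _ = _
  good-++ˡ (x ∷ xs) p = proj₁ (path-++⁻ 0F x xs p)

  good-take : ∀ n xs → Good xs → Good (take n xs)
  good-take n xs p = good-++ˡ (take n xs) (subst Good (sym (List.take++drop≡id n xs)) p)

  advance-quotient : ∀ i q n → advance i (n + q * 4) ≡ advance i n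
  advance-quotient i  q       (suc n) = advance-quotient (next i) q n
  advance-quotient i  zero    zero    = refl
  advance-quotient 0F (suc q) zero    = advance-quotient 0F q zero
  advance-quotient 1F (suc q) zero    = advance-quotient 1F q zero
  advance-quotient 2F (suc q) zero    = advance-quotient 2F q zero
  advance-quotient 3F (suc q) zero    = advance-quotient 3F q zero

  advance-remainder : ∀ h q → advance 0F (toℕ h + q * 4) ≡ h
  advance-remainder h q = trans (advance-quotient 0F q (toℕ h)) (lemma h)
    where
    lemma : ∀ h → advance 0F (toℕ h) ≡ h
    lemma 0F = refl
    lemma 1F = refl
    lemma 2F = refl
    lemma 3F = refl

  -- A list of n + 1 entries makes n steps, so a fall is due only after a positive multiple of 4
  -- entries.
  advance≡3 : ∀ n → advance 0F n ≡ 3F → ∃[ q ] suc n ≡ suc q * 4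
  advance≡3 n eq with n divMod 4
  ... | result q h refl with refl ← trans (sym (advance-remainder h q)) eq = q , refl

  rise : ∀ {i x y} → i ≢ 3F → x < y → Moves i x y
  rise {0F} _ x<y = x<y
  rise {1F} _ x<y = x<y
  rise {2F} _ x<y = x<y
  rise {3F} i≢3 _ = contradiction refl i≢3

  fall⁻ : ∀ {i x y} → Moves i x y → y ≤ x → i ≡ 3F
  fall⁻ {0F} x<y y≤x = contradiction x<y (ℕ.≤⇒≯ y≤x)
  fall⁻ {1F} x<y y≤x = contradiction x<y (ℕ.≤⇒≯ y≤x)
  fall⁻ {2F} x<y y≤x = contradiction x<y (ℕ.≤⇒≯ y≤x)
  fall⁻ {3F} _   _   = refl

  reach : State → ℕ
  reach (c , h) = toℕ h + c * 4

  quotient≤ : ∀ q s → q * 4 ≤ reach s → q ≤ proj₁ s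
  quotient≤ q (c , h) p = ℕ.s≤s⁻¹ (ℕ.*-cancelʳ-< 4 q (suc c) (ℕ.≤-<-trans p (ℕ.+-monoˡ-< (c * 4) (Fin.toℕ<n h))))

  up-≤ : ∀ s → reach s ≤ reach (up s)
  up-≤ (c     , 1F) = ℕ.n≤1+n _
  up-≤ (c     , 2F) = ℕ.n≤1+n _
  up-≤ (c     , 3F) = ℕ.n≤1+n _
  up-≤ (zero  , 0F) = z≤n
  up-≤ (suc c , 0F) = ℕ.≤-refl

  up-positive : ∀ s → 1 ≤ reach (up s)
  up-positive (c     , 1F) = s≤s z≤n
  up-positive (c     , 2F) = s≤s z≤n
  up-positive (c     , 3F) = s≤s z≤n
  up-positive (zero  , 0F) = s≤s z≤n
  up-positive (suc c , 0F) = s≤s z≤n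

  -- A good subsequence is extended by a larger last entry only if its length is not a multiple of 4.
  up-suc : ∀ s n → suc n ≤ reach s → advance 0F n ≢ 3F → suc (suc n) ≤ reach (up s)
  up-suc (c     , 1F) n p ne = s≤s p
  up-suc (c     , 2F) n p ne = s≤s p
  up-suc (c     , 3F) n p ne = s≤s p
  up-suc (suc c , 0F) n p ne = ℕ.≤∧≢⇒< p λ eq →
    ne (trans (cong (advance 0F) (ℕ.suc-injective eq)) (advance-remainder 3F c))

  ⊔-≤ˡ : ∀ {n} (i j : Fin n) → toℕ i ≤ toℕ (i ⊔ j)
  ⊔-≤ˡ Fin.zero    j           = z≤n
  ⊔-≤ˡ (Fin.suc i) Fin.zero    = ℕ.≤-refl
  ⊔-≤ˡ (Fin.suc i) (Fin.suc j) = s≤s (⊔-≤ˡ i j)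

  ⊔-≤ʳ : ∀ {n} (i j : Fin n) → toℕ j ≤ toℕ (i ⊔ j)
  ⊔-≤ʳ Fin.zero    j           = ℕ.≤-refl
  ⊔-≤ʳ (Fin.suc i) Fin.zero    = z≤n
  ⊔-≤ʳ (Fin.suc i) (Fin.suc j) = s≤s (⊔-≤ʳ i j)

  ⊔-sel : ∀ {n} (i j : Fin n) → i ⊔ j ≡ i ⊎ i ⊔ j ≡ j
  ⊔-sel Fin.zero    j           = inj₂ refl
  ⊔-sel (Fin.suc i) Fin.zero    = inj₁ refl
  ⊔-sel (Fin.suc i) (Fin.suc j) with ⊔-sel i j
  ... | inj₁ eq = inj₁ (cong Fin.suc eq)
  ... | inj₂ eq = inj₂ (cong Fin.suc eq)

  join-suc : ∀ c d h → c * 4 + reach (suc d , h) ≡ reach (suc (c + d) , h)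
  join-suc c d h = begin
    c * 4 + (toℕ h + suc d * 4)    ≡⟨ ℕ.+-assoc (c * 4) (toℕ h) _ ⟨
    c * 4 + toℕ h + suc d * 4      ≡⟨ cong (_+ suc d * 4) (ℕ.+-comm (c * 4) (toℕ h)) ⟩
    toℕ h + c * 4 + suc d * 4      ≡⟨ ℕ.+-assoc (toℕ h) (c * 4) _ ⟩
    toℕ h + (c * 4 + suc d * 4)    ≡⟨ cong (toℕ h +_) (ℕ.*-distribʳ-+ 4 c (suc d)) ⟨
    toℕ h + (c + suc d) * 4        ≡⟨ cong (λ m → toℕ h + m * 4) (ℕ.+-suc c d) ⟩
    toℕ h + suc (c + d) * 4        ∎
    where open ≡-Reasoning

  join-≤ˡ : ∀ s u → reach s ≤ reach (join s u)
  join-≤ˡ (c , h) (zero  , k) = ℕ.+-monoˡ-≤ (c * 4) (⊔-≤ˡ h k)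
  join-≤ˡ (c , h) (suc d , k) = begin
    toℕ h + c * 4              ≤⟨ ℕ.+-mono-≤ (ℕ.<⇒≤ (Fin.toℕ<n h)) (ℕ.*-monoˡ-≤ 4 (ℕ.m≤m+n c d)) ⟩
    suc (c + d) * 4            ≤⟨ ℕ.m≤n+m _ (toℕ k) ⟩
    toℕ k + suc (c + d) * 4    ∎
    where open ℕ.≤-Reasoning

  join-≤ʳ : ∀ s u → proj₁ s * 4 + reach u ≤ reach (join s u)
  join-≤ʳ (c , h) (zero  , k) = begin
    c * 4 + (toℕ k + 0)      ≡⟨ cong (c * 4 +_) (ℕ.+-identityʳ (toℕ k)) ⟩
    c * 4 + toℕ k            ≡⟨ ℕ.+-comm (c * 4) (toℕ k) ⟩
    toℕ k + c * 4            ≤⟨ ℕ.+-monoˡ-≤ (c * 4) (⊔-≤ʳ h k) ⟩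
    toℕ (h ⊔ k) + c * 4      ∎
    where open ℕ.≤-Reasoning
  join-≤ʳ (c , h) (suc d , k) = ℕ.≤-reflexive (join-suc c d k)

  -- Where the subsequence leaves the high part it falls. So it has taken a multiple of 4 entries
  -- there, hence at most 4 c, and the remainder starts afresh in phase 0.
  good-length≤ : ∀ lo t xs → xs ⊆ code lo t → Good xs → length xs ≤ reach (state t)
  tree-length≤ : ∀ lo l xs → xs ⊆ code lo l ++ [ lo + size l ] → Good xs → length xs ≤ reach (up (state l))

  good-length≤ lo leaf       .[] []  _ = z≤n
  good-length≤ lo (node r l) xs s p with ⊆-++⁻ (code (suc (lo + size l)) r) s
  ... | ys , [] , refl , s₁ , _ = ℕ.≤-trans
    (good-length≤ _ r (ys ++ []) (subst (_⊆ _) (sym (List.++-identityʳ ys)) s₁) p)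
    (join-≤ˡ (state r) (up (state l)))
  ... | [] , zs@(_ ∷ _) , refl , _ , s₂ = ℕ.≤-trans (tree-length≤ lo l zs s₂ p)
    (ℕ.≤-trans (ℕ.m≤n+m _ (proj₁ (state r) * 4)) (join-≤ʳ (state r) (up (state l))))
  ... | y ∷ ys , z ∷ zs , refl , s₁ , s₂ with path-++⁻ 0F y ys p
  ...   | p₁ , (m , p₂) = ℕ.≤-trans (ℕ.≤-reflexive (List.length-++ (y ∷ ys)))
      (ℕ.≤-trans (ℕ.+-mono-≤ blocks (tree-length≤ lo l (z ∷ zs) s₂ (subst (λ i → Path i z zs) (cong next 3≡) p₂)))
                 (join-≤ʳ (state r) (up (state l))))
    where
    falls : z ≤ last y ys
    falls = ℕ.≤-trans (All.lookup (code-tree-below lo l) (∈-⊆ s₂))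
                      (ℕ.<⇒≤ (last-all (All-resp-⊆ s₁ (code-above lo r l))))
    3≡ : advance 0F (length ys) ≡ 3F
    3≡ = fall⁻ m falls
    blocks : length (y ∷ ys) ≤ proj₁ (state r) * 4
    blocks with advance≡3 (length ys) 3≡ | good-length≤ _ r (y ∷ ys) s₁ p₁
    ... | k , eq | len = ℕ.≤-trans (ℕ.≤-reflexive eq)
      (ℕ.*-monoˡ-≤ 4 (quotient≤ (suc k) (state r) (ℕ.≤-trans (ℕ.≤-reflexive (sym eq)) len)))

  tree-length≤ lo l xs s p with ⊆-++⁻ (code lo l) s
  ... | ys , [] , refl , s₁ , _ = ℕ.≤-trans
    (good-length≤ lo l (ys ++ []) (subst (_⊆ _) (sym (List.++-identityʳ ys)) s₁) p) (up-≤ (state l))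
  ... | ys , _ ∷ _ ∷ _ , refl , _ , _ ∷ʳ ()
  ... | ys , _ ∷ _ ∷ _ , refl , _ , refl ∷ ()
  ... | [] , _ ∷ [] , refl , _ , _ = up-positive (state l)
  ... | y ∷ ys , _ ∷ [] , refl , s₁ , refl ∷ [] with path-++⁻ 0F y ys p
  ...   | p₁ , (m , _) = ℕ.≤-trans
      (ℕ.≤-reflexive (trans (List.length-++ (y ∷ ys)) (ℕ.+-comm _ 1)))
      -- In phase 3 a fall would be due, but the root exceeds every entry of the low part.
      (up-suc (state l) (length ys) (good-length≤ lo l (y ∷ ys) s₁ p₁) λ 3≡ →
        subst (λ i → Moves i (last y ys) (lo + size l)) 3≡ m (last-all (All-resp-⊆ s₁ (code-below lo l))))

  Longest : List ℕ → ℕ → Set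
  Longest xs n = ∃[ ys ] ys ⊆ xs × Good ys × length ys ≡ n

  -- An optimal list of the high part, cut back to 4 c entries, has a fall due. Stepping down into
  -- the low part provides it, and an optimal list of that part can be appended. If `join` keeps the
  -- phase of the right child, its own list is already long enough.
  longest-code : ∀ lo t → Longest (code lo t) (reach (state t))
  longest-tree : ∀ lo l → Longest (code lo l ++ [ lo + size l ]) (reach (up (state l)))

  longest-code lo leaf       = [] , [] , _ , refl
  longest-code lo (node r l) with longest-code (suc (lo + size l)) r | longest-tree lo l
  ... | ys , ys⊆ , good-ys , |ys| | zs , zs⊆ , good-zs , |zs| = joined (state r) (up (state l)) |ys| |zs|
    where
    high = code (suc (lo + size l)) r
    low  = code lo l ++ [ lo + size l ]
    keep : ∀ {n} → length ys ≡ n → Longest (high ++ low) n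
    keep eq = ys , subst (_⊆ high ++ low) (List.++-identityʳ ys) (++⁺ ys⊆ (minimum low)) , good-ys , eq
    glue : ∀ c → c * 4 ≤ length ys → Longest (high ++ low) (c * 4 + length zs)
    glue c c≤ = take (c * 4) ys ++ zs , ++⁺ prefix⊆ zs⊆ , good (take (c * 4) ys) zs prefix⊆ zs⊆ |prefix| (good-take (c * 4) ys good-ys) good-zs ,
      trans (List.length-++ (take (c * 4) ys)) (cong (_+ length zs) |prefix|)
      where
      prefix⊆ : take (c * 4) ys ⊆ high
      prefix⊆ = ⊆-trans (take-⊆ (c * 4) ys) ys⊆
      |prefix| : length (take (c * 4) ys) ≡ c * 4
      |prefix| = trans (List.length-take (c * 4) ys) (ℕ.m≤n⇒m⊓n≡m c≤)
      good : ∀ as bs → as ⊆ high → bs ⊆ low → length as ≡ c * 4 → Good as → Good bs → Good (as ++ bs)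
      good []       bs       _   _   _    _ q = q
      good (a ∷ as) []       _   _   _    p _ = path-++⁺ 0F a as p _
      good (a ∷ as) (b ∷ bs) as⊆ bs⊆ |as| p q = path-++⁺ 0F a as p (at-end c |as|)
        where
        falls : ¬ last a as < b
        falls = ℕ.<⇒≯ (ℕ.≤-<-trans (All.lookup (code-tree-below lo l) (∈-⊆ bs⊆))
                                   (last-all (All-resp-⊆ as⊆ (code-above lo r l))))
        at-end : ∀ c → suc (length as) ≡ c * 4 → Path (advance 0F (length as)) (last a as) (b ∷ bs)
        at-end (suc c) eq = subst (λ i → Path i (last a as) (b ∷ bs))
          (sym (trans (cong (advance 0F) (ℕ.suc-injective eq)) (advance-remainder 3F c))) (falls , q)
    joined : ∀ s u → length ys ≡ reach s → length zs ≡ reach u →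
             Longest (high ++ low) (reach (join s u))
    joined (c , h) (suc d , k) eq eq′ = subst (Longest _) (trans (cong (c * 4 +_) eq′) (join-suc c d k))
      (glue c (ℕ.≤-trans (ℕ.m≤n+m (c * 4) (toℕ h)) (ℕ.≤-reflexive (sym eq))))
    joined (c , h) (zero , k) eq eq′ with ⊔-sel h k
    ... | inj₁ h-wins rewrite h-wins = keep eq
    ... | inj₂ k-wins rewrite k-wins = subst (Longest _)
      (trans (cong (c * 4 +_) (trans eq′ (ℕ.+-identityʳ (toℕ k)))) (ℕ.+-comm (c * 4) (toℕ k)))
      (glue c (ℕ.≤-trans (ℕ.m≤n+m (c * 4) (toℕ h)) (ℕ.≤-reflexive (sym eq))))

  longest-tree lo l with longest-code lo l
  ... | ys , ys⊆ , good-ys , |ys| = upped (state l) |ys|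
    where
    root = lo + size l
    keep : ∀ {n} → length ys ≡ n → Longest (code lo l ++ [ root ]) n
    keep eq = ys , subst (_⊆ code lo l ++ [ root ]) (List.++-identityʳ ys) (++⁺ ys⊆ (minimum [ root ])) , good-ys , eq
    extend : ∀ c (h : Fin 4) → h ≢ 3F → length ys ≡ suc (toℕ h + c * 4) → Longest (code lo l ++ [ root ]) (suc (suc (toℕ h + c * 4)))
    extend c h h≢3 eq = ys ++ [ root ] , ++⁺ ys⊆ ⊆-refl , good ys ys⊆ good-ys eq ,
      trans (List.length-++ ys) (trans (ℕ.+-comm (length ys) 1) (cong suc eq))
      where
      good : ∀ as → as ⊆ code lo l → Good as → length as ≡ suc (toℕ h + c * 4) → Good (as ++ [ root ])
      good (a ∷ as) as⊆ p eq = path-++⁺ 0F a as p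
        (rise (λ 3≡ → h≢3 (trans (sym (trans (cong (advance 0F) (ℕ.suc-injective eq)) (advance-remainder h c))) 3≡))
              (last-all (All-resp-⊆ as⊆ (code-below lo l))) , _)
    upped : ∀ s → length ys ≡ reach s → Longest (code lo l ++ [ root ]) (reach (up s))
    upped (c     , 1F) eq = extend c 0F (λ ()) eq
    upped (c     , 2F) eq = extend c 1F (λ ()) eq
    upped (c     , 3F) eq = extend c 2F (λ ()) eq
    upped (suc c , 0F) eq = keep eq
    -- The empty list has no last entry to rise from; the root alone gives length 1.
    upped (zero  , 0F) eq = [ root ] , ++⁺ (minimum (code lo l)) ⊆-refl , _ , refl

  -- Repetitions of UUUD among the subsequences of a word.

  ∈-subsequences⁺ : ∀ {A : Set} {ys xs : List A} → ys ⊆ xs → ys ∈ subsequences xs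
  ∈-subsequences⁺ []                    = here refl
  ∈-subsequences⁺ {xs = x ∷ xs} (_ ∷ʳ s)   = ∈.∈-++⁺ʳ (map (x ∷_) (subsequences xs)) (∈-subsequences⁺ s)
  ∈-subsequences⁺ {xs = x ∷ xs} (refl ∷ s) = ∈.∈-++⁺ˡ (∈.∈-map⁺ (x ∷_) (∈-subsequences⁺ s))

  ∈-subsequences⁻ : ∀ {A : Set} {ys : List A} xs → ys ∈ subsequences xs → ys ⊆ xs
  ∈-subsequences⁻ []       (here refl) = []
  ∈-subsequences⁻ (x ∷ xs) ys∈ with ∈.∈-++⁻ (map (x ∷_) (subsequences xs)) ys∈
  ... | inj₂ ys∈₂ = x ∷ʳ ∈-subsequences⁻ xs ys∈₂
  ... | inj₁ ys∈₁ with zs , zs∈ , refl ← ∈.∈-map⁻ (x ∷_) ys∈₁ = refl ∷ ∈-subsequences⁻ xs zs∈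

  step : Fin 4 → Step
  step 3F = D
  step _  = U

  wave : Fin 4 → ℕ → List Step
  wave i zero    = []
  wave i (suc n) = step i ∷ wave (next i) n

  length-wave : ∀ i n → length (wave i n) ≡ n
  length-wave i zero    = refl
  length-wave i (suc n) = cong suc (length-wave (next i) n)

  wave-blocks : ∀ k → concat (replicate k (U ∷ U ∷ U ∷ D ∷ [])) ≡ wave 0F (k * 4)
  wave-blocks zero    = refl
  wave-blocks (suc k) = cong (λ w → U ∷ U ∷ U ∷ D ∷ w) (wave-blocks k)

  moves⇒step : ∀ {n} i (x y : Fin n) → Moves i (toℕ x) (toℕ y) → (if does (x Fin.<? y) then U else D) ≡ step i
  moves⇒step i x y m with toℕ x ℕ.<ᵇ toℕ y | ℕ.<ᵇ-reflects-< (toℕ x) (toℕ y)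
  moves⇒step 0F x y m | true  | ofʸ _ = refl
  moves⇒step 1F x y m | true  | ofʸ _ = refl
  moves⇒step 2F x y m | true  | ofʸ _ = refl
  moves⇒step 3F x y m | true  | ofʸ p = contradiction p m
  moves⇒step 0F x y m | false | ofⁿ ¬p = contradiction m ¬p
  moves⇒step 1F x y m | false | ofⁿ ¬p = contradiction m ¬p
  moves⇒step 2F x y m | false | ofⁿ ¬p = contradiction m ¬p
  moves⇒step 3F x y m | false | ofⁿ _  = refl

  step⇒moves : ∀ {n} i (x y : Fin n) → (if does (x Fin.<? y) then U else D) ≡ step i → Moves i (toℕ x) (toℕ y)
  step⇒moves i x y eq with toℕ x ℕ.<ᵇ toℕ y | ℕ.<ᵇ-reflects-< (toℕ x) (toℕ y)
  step⇒moves 0F x y eq | true  | ofʸ p = p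
  step⇒moves 1F x y eq | true  | ofʸ p = p
  step⇒moves 2F x y eq | true  | ofʸ p = p
  step⇒moves 3F x y () | true  | ofʸ _
  step⇒moves 0F x y () | false | ofⁿ _
  step⇒moves 1F x y () | false | ofⁿ _
  step⇒moves 2F x y () | false | ofⁿ _
  step⇒moves 3F x y eq | false | ofⁿ ¬p = ¬p

  path⇒wave : ∀ {n} i (x : Fin n) ys → Path i (toℕ x) (map toℕ ys) → upDown (x ∷ ys) ≡ wave i (length ys)
  path⇒wave i x []       _       = refl
  path⇒wave i x (y ∷ ys) (m , p) = cong₂ _∷_ (moves⇒step i x y m) (path⇒wave (next i) y ys p)

  wave⇒path : ∀ {n} i (x : Fin n) ys → upDown (x ∷ ys) ≡ wave i (length ys) → Path i (toℕ x) (map toℕ ys)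
  wave⇒path i x []       _  = _
  wave⇒path i x (y ∷ ys) eq = step⇒moves i x y (List.∷-injectiveˡ eq) , wave⇒path (next i) y ys (List.∷-injectiveʳ eq)

  length-upDown-∷ : ∀ {n} (x : Fin n) ys → length (upDown (x ∷ ys)) ≡ length ys
  length-upDown-∷ x []       = refl
  length-upDown-∷ x (y ∷ ys) = cong suc (length-upDown-∷ y ys)

  repeats⇒good : ∀ {n} (xs : List (Fin n)) → Repeats U³D xs → ∃[ k ] length xs ≡ suc (k * 4) × Good (map toℕ xs)
  repeats⇒good []       (suc k , _ , ())
  repeats⇒good (x ∷ xs) (k , _ , eq) = k , cong suc len ,
    wave⇒path 0F x xs (trans eq (trans (wave-blocks k) (cong (wave 0F) (sym len))))
    where
    len : length xs ≡ k * 4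
    len = trans (sym (length-upDown-∷ x xs))
      (trans (cong length (trans eq (wave-blocks k))) (length-wave 0F (k * 4)))

  good⇒repeats : ∀ {n} k (xs : List (Fin n)) → 1 ≤ k → length xs ≡ suc (k * 4) → Good (map toℕ xs) → Repeats U³D xs
  good⇒repeats k (x ∷ xs) 1≤k len p = k , 1≤k ,
    trans (path⇒wave 0F x xs p) (trans (cong (wave 0F) (ℕ.suc-injective len)) (sym (wave-blocks k)))

  -- A repetition of length 4 k + 1 is a good list, so 4 k is at most `reach` of the state, and k at
  -- most the number of completed blocks.
  L-upper : ∀ {n} (σ : Word n n) t → values σ ≡ code 0 t → L U³D σ ≤ suc (completions t * 4)
  L-upper σ t eq = Extrema.max≤v⁺ z≤n (All.map⁺ (All.tabulate bound))
    where
    bound : ∀ {xs} → xs ∈ _ → length xs ≤ suc (completions t * 4)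
    bound {xs} xs∈ with ∈.∈-filter⁻ (repeats? U³D) {xs = subsequences (Vec.toList σ)} xs∈
    ... | xs∈′ , rep with repeats⇒good xs rep
    ...   | k , len , good = ℕ.≤-trans (ℕ.≤-reflexive len)
        (s≤s (ℕ.*-monoˡ-≤ 4 (quotient≤ k (state t) (ℕ.≤-trans (ℕ.n≤1+n _) (ℕ.≤-trans
          (ℕ.≤-reflexive (trans (sym len) (sym (List.length-map toℕ xs))))
          (good-length≤ 0 t (map toℕ xs) (subst (map toℕ xs ⊆_) eq (map⁺ toℕ (∈-subsequences⁻ (Vec.toList σ) xs∈′))) good))))))

  -- 4 c entries make only 4 c - 1 steps, so c completed blocks guarantee just c - 1 repetitions,
  -- read off the first 4 (c - 1) + 1 entries. For c at most 1 the summand 4 suffices.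
  L-lower : ∀ {n} (σ : Word n n) t → values σ ≡ code 0 t → completions t * 4 ≤ L U³D σ + 4
  L-lower σ t eq with longest-code 0 t
  ... | ys , ys⊆ , good , |ys| = bound (completions t)
      (ℕ.≤-trans (ℕ.m≤n+m (completions t * 4) (toℕ (proj₂ (state t)))) (ℕ.≤-reflexive (sym |ys|)))
    where
    prefix : ∀ k → 1 ≤ k → suc (k * 4) ≤ length ys → suc (k * 4) ≤ L U³D σ
    prefix k 1≤k len with ⊆-map⁻ toℕ (Vec.toList σ) (⊆-trans (take-⊆ (suc (k * 4)) ys) (subst (ys ⊆_) (sym eq) ys⊆))
    ... | xs , eq′ , xs⊆ = Extrema.v≤max⁺ 0 _ (inj₂ (Any.map (λ { refl → ℕ.≤-reflexive (sym |xs|) })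
        (∈.∈-map⁺ length (∈.∈-filter⁺ (repeats? U³D) (∈-subsequences⁺ xs⊆)
          (good⇒repeats k xs 1≤k |xs| (subst Good eq′ (good-take (suc (k * 4)) ys good)))))))
      where
      |xs| : length xs ≡ suc (k * 4)
      |xs| = trans (sym (List.length-map toℕ xs)) (trans (cong length (sym eq′))
        (trans (List.length-take (suc (k * 4)) ys) (ℕ.m≤n⇒m⊓n≡m len)))
    bound : ∀ c → c * 4 ≤ length ys → c * 4 ≤ L U³D σ + 4
    bound zero          _   = z≤n
    bound (suc zero)    _   = ℕ.m≤n+m 4 _
    bound (suc (suc c)) len = ℕ.≤-trans (ℕ.≤-reflexive (ℕ.+-comm 4 (suc c * 4)))
      (ℕ.+-monoˡ-≤ 4 (ℕ.≤-trans (ℕ.n≤1+n _) (prefix (suc c) (s≤s z≤n)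
        (ℕ.≤-trans (s≤s (ℕ.m≤n+m (suc c * 4) 3)) len))))

open Longest using (L-upper; L-lower)

-- From totals over trees to the expectation of `L`.

module Asymptotics where

  open import Data.Integer as ℤ using (ℤ; +_; 1ℤ; ∣_∣; _+_; _*_; -_)
  import Data.Integer.Properties as ℤ
  open import Data.Integer.Tactic.RingSolver using (solve-∀)
  open import Data.List.Base using (List; []; _∷_; map; length)
  import Data.List.Properties as List
  open import Data.List.Membership.Propositional using (_∈_)
  import Data.List.Membership.Propositional.Properties as ∈
  open import Data.List.Relation.Binary.Permutation.Propositional using (_↭_; ↭-sym)
  open import Data.List.Relation.Binary.Permutation.Propositional.Properties as ↭ using (↭-map-inv; ↭-length)
  open import Data.List.Relation.Unary.All as All using ([]; _∷_)
  open import Data.Nat as ℕ using (ℕ; zero; suc; z≤n; _≤_)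
  import Data.Nat.Properties as ℕ
  import Data.Nat.Tactic.RingSolver as ℕ-Ring
  open import Data.Nat.ListAction using (sum)
  open import Data.Nat.ListAction.Properties using (sum-↭)
  open import Data.Product using (Σ-syntax; ∃-syntax; _,_)
  open import Data.Rational as ℚ using (ℚ; mkℚ; 0ℚ; 1ℚ)
  import Data.Rational.Properties as ℚ
  open import Data.Rational.Unnormalised as ℚᵘ using (ℚᵘ; mkℚᵘ; *<*)
  import Data.Rational.Unnormalised.Properties as ℚᵘ
  open import Data.Sum using (inj₁; inj₂)
  open import Relation.Binary.PropositionalEquality using (_≡_; refl; sym; trans; cong; cong₂; subst; subst₂)

  sum-L-upper : ∀ {n} (σs : List (Word n n)) ts → map values σs ≡ map (code 0) ts →
                sum (map (L U³D) σs) ≤ length ts ℕ.+ sum (map completions ts) ℕ.* 4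
  sum-L-upper []       []       eq = z≤n
  sum-L-upper (σ ∷ σs) (t ∷ ts) eq = begin
    L U³D σ ℕ.+ sum (map (L U³D) σs)                  ≤⟨ ℕ.+-mono-≤ (L-upper σ t (List.∷-injectiveˡ eq)) (sum-L-upper σs ts (List.∷-injectiveʳ eq)) ⟩
    suc (completions t ℕ.* 4) ℕ.+ (length ts ℕ.+ C ℕ.* 4)    ≡⟨ lemma (completions t) (length ts) C ⟩
    suc (length ts) ℕ.+ (completions t ℕ.+ C) ℕ.* 4          ∎
    where
    open ℕ.≤-Reasoning
    C = sum (map completions ts)
    lemma : ∀ a b c → suc (a ℕ.* 4) ℕ.+ (b ℕ.+ c ℕ.* 4) ≡ suc b ℕ.+ (a ℕ.+ c) ℕ.* 4
    lemma = ℕ-Ring.solve-∀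

  sum-L-lower : ∀ {n} (σs : List (Word n n)) ts → map values σs ≡ map (code 0) ts →
                sum (map completions ts) ℕ.* 4 ≤ sum (map (L U³D) σs) ℕ.+ length ts ℕ.* 4
  sum-L-lower []       []       eq = z≤n
  sum-L-lower (σ ∷ σs) (t ∷ ts) eq = begin
    (completions t ℕ.+ sum (map completions ts)) ℕ.* 4             ≡⟨ ℕ.*-distribʳ-+ 4 (completions t) _ ⟩
    completions t ℕ.* 4 ℕ.+ sum (map completions ts) ℕ.* 4         ≤⟨ ℕ.+-mono-≤ (L-lower σ t (List.∷-injectiveˡ eq)) (sum-L-lower σs ts (List.∷-injectiveʳ eq)) ⟩
    L U³D σ ℕ.+ 4 ℕ.+ (s ℕ.+ length ts ℕ.* 4)                      ≡⟨ lemma (L U³D σ) s (length ts) ⟩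
    L U³D σ ℕ.+ s ℕ.+ suc (length ts) ℕ.* 4                        ∎
    where
    open ℕ.≤-Reasoning
    s = sum (map (L U³D) σs)
    lemma : ∀ a b c → a ℕ.+ 4 ℕ.+ (b ℕ.+ c ℕ.* 4) ≡ a ℕ.+ b ℕ.+ suc c ℕ.* 4
    lemma = ℕ-Ring.solve-∀

  ∣difference∣≤ : ∀ {a b k} → a ≤ k ℕ.+ b → b ≤ k ℕ.+ a → ∣ + a + - (+ b) ∣ ≤ k
  ∣difference∣≤ {a} {b} {k} a≤ b≤ rewrite ℤ.m-n≡m⊖n a b with ℕ.≤-total b a
  ... | inj₁ b≤a rewrite ℤ.⊖-≥ b≤a = ℕ.m≤n+o⇒m∸n≤o a b (ℕ.≤-trans a≤ (ℕ.≤-reflexive (ℕ.+-comm k b)))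
  ... | inj₂ a≤b rewrite ℤ.∣m⊖n∣≡∣n⊖m∣ a b | ℤ.⊖-≥ a≤b = ℕ.m≤n+o⇒m∸n≤o b a (ℕ.≤-trans b≤ (ℕ.≤-reflexive (ℕ.+-comm k a)))

  -- 11 s - 4 n m splits into 11 (s - 4 c), which is at most 44 m, twice the quantity bounded by K
  -- m, and 4 m, which corrects n + 1 to n. This is the origin of 48 + 2 K.
  mean-deviation : ∀ s c m n K → s ≤ m ℕ.+ c ℕ.* 4 → c ℕ.* 4 ≤ s ℕ.+ m ℕ.* 4 →
    ∣ + 22 * + c + - (+ 2) * (+ suc n * + m) ∣ ≤ K ℕ.* m →
    ∣ + s * + 11 + - (+ 4 * + n) * + m ∣ ≤ (48 ℕ.+ 2 ℕ.* K) ℕ.* m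
  mean-deviation s c m n K upper lower mid = begin
    ∣ + s * + 11 + - (+ 4 * + n) * + m ∣        ≡⟨ cong ∣_∣ (trans (split (+ s) (+ c) (+ m) (+ n)) (cong (λ z → + 11 * (+ s + - z) + + 2 * y + + 4 * + m) (sym (ℤ.pos-* c 4)))) ⟩
    ∣ + 11 * x + + 2 * y + + 4 * + m ∣           ≤⟨ ℤ.∣i+j∣≤∣i∣+∣j∣ (+ 11 * x + + 2 * y) (+ 4 * + m) ⟩
    ∣ + 11 * x + + 2 * y ∣ ℕ.+ ∣ + 4 * + m ∣     ≤⟨ ℕ.+-monoˡ-≤ _ (ℤ.∣i+j∣≤∣i∣+∣j∣ (+ 11 * x) (+ 2 * y)) ⟩
    ∣ + 11 * x ∣ ℕ.+ ∣ + 2 * y ∣ ℕ.+ ∣ + 4 * + m ∣  ≡⟨ cong₂ ℕ._+_ (cong₂ ℕ._+_ (ℤ.abs-* (+ 11) x) (ℤ.abs-* (+ 2) y)) (ℤ.abs-* (+ 4) (+ m)) ⟩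
    11 ℕ.* ∣ x ∣ ℕ.+ 2 ℕ.* ∣ y ∣ ℕ.+ 4 ℕ.* m    ≤⟨ ℕ.+-monoˡ-≤ (4 ℕ.* m) (ℕ.+-mono-≤ (ℕ.*-monoʳ-≤ 11 x≤) (ℕ.*-monoʳ-≤ 2 mid)) ⟩
    11 ℕ.* (m ℕ.* 4) ℕ.+ 2 ℕ.* (K ℕ.* m) ℕ.+ 4 ℕ.* m  ≡⟨ collect m K ⟩
    (48 ℕ.+ 2 ℕ.* K) ℕ.* m                       ∎
    where
    open ℕ.≤-Reasoning
    x = + s + - (+ (c ℕ.* 4))
    y = + 22 * + c + - (+ 2) * (+ suc n * + m)
    x≤ : ∣ x ∣ ≤ m ℕ.* 4
    x≤ = ∣difference∣≤ (ℕ.≤-trans upper (ℕ.+-monoˡ-≤ _ (ℕ.m≤m*n m 4))) (ℕ.≤-trans lower (ℕ.≤-reflexive (ℕ.+-comm s _)))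
    split : ∀ s c m n → s * + 11 + - (+ 4 * n) * m ≡ + 11 * (s + - (c * + 4)) + + 2 * (+ 22 * c + - (+ 2) * ((1ℤ + n) * m)) + + 4 * m
    split = solve-∀
    collect : ∀ m K → 11 ℕ.* (m ℕ.* 4) ℕ.+ 2 ℕ.* (K ℕ.* m) ℕ.+ 4 ℕ.* m ≡ (48 ℕ.+ 2 ℕ.* K) ℕ.* m
    collect = ℕ-Ring.solve-∀

  expected : ℕ → ℚ
  expected n = (+ 4 ℚ./ 11) ℚ.* (+ n ℚ./ 1)

  expectedᵘ : ∀ n → ℚ.toℚᵘ (expected n) ℚᵘ.≃ mkℚᵘ (+ 4) 10 ℚᵘ.* mkℚᵘ (+ n) 0
  expectedᵘ n = ℚᵘ.≃-trans (ℚ.toℚᵘ-homo-* (+ 4 ℚ./ 11) (+ n ℚ./ 1))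
    (ℚᵘ.*-cong (ℚᵘ.≃-refl {ℚ.toℚᵘ (+ 4 ℚ./ 11)}) (ℚ.toℚᵘ-fromℚᵘ (mkℚᵘ (+ n) 0)))

  expected-positive : ∀ n → ℚ.Positive (expected (suc n))
  expected-positive n = ℚ.pos*pos⇒pos (+ 4 ℚ./ 11) (+ suc n ℚ./ 1) {{ℚ.normalize-pos (suc n) 1}}

  quotient-near-1 : ∀ x y {ε} (y>0 : ℚ.Positive y) → ℚ.∣ x ℚ.- y ∣ ℚ.< ε ℚ.* y →
                    ℚ.∣ (x ℚ.÷ y) {{ℚ.pos⇒nonZero y {{y>0}}}} ℚ.- 1ℚ ∣ ℚ.< ε
  quotient-near-1 x y {ε} y>0 near = ℚ.*-cancelʳ-<-nonNeg y {{ℚ.pos⇒nonNeg y {{y>0}}}} (begin-strict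
    ℚ.∣ x ℚ.* 1/y ℚ.- 1ℚ ∣ ℚ.* y             ≡⟨ cong (ℚ.∣ x ℚ.* 1/y ℚ.- 1ℚ ∣ ℚ.*_) (ℚ.0≤p⇒∣p∣≡p (ℚ.<⇒≤ (ℚ.positive⁻¹ y {{y>0}}))) ⟨
    ℚ.∣ x ℚ.* 1/y ℚ.- 1ℚ ∣ ℚ.* ℚ.∣ y ∣       ≡⟨ ℚ.∣p*q∣≡∣p∣*∣q∣ (x ℚ.* 1/y ℚ.- 1ℚ) y ⟨
    ℚ.∣ (x ℚ.* 1/y ℚ.- 1ℚ) ℚ.* y ∣           ≡⟨ cong ℚ.∣_∣ cancel ⟩
    ℚ.∣ x ℚ.- y ∣                            <⟨ near ⟩
    ε ℚ.* y                                  ∎)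
    where
    open ℚ.≤-Reasoning
    instance
      y≢0 : ℚ.NonZero y
      y≢0 = ℚ.pos⇒nonZero y {{y>0}}
    1/y = ℚ.1/ y
    cancel : (x ℚ.* 1/y ℚ.- 1ℚ) ℚ.* y ≡ x ℚ.- y
    cancel = trans (ℚ.*-distribʳ-+ y (x ℚ.* 1/y) (ℚ.- 1ℚ)) (cong₂ ℚ._+_
      (trans (ℚ.*-assoc x 1/y y) (trans (cong (x ℚ.*_) (ℚ.*-inverseˡ y)) (ℚ.*-identityʳ x)))
      (trans (sym (ℚ.neg-distribˡ-* 1ℚ y)) (cong ℚ.-_ (ℚ.*-identityˡ y))))

  -- The denominator of ε bounds 1/ε from above.
  ratio-near-1 : ∀ K s m n x ε → ℚ.toℚᵘ x ℚᵘ.≃ mkℚᵘ (+ s) m → 0ℚ ℚ.< ε → K ℕ.* ℚ.↧ₙ ε ℕ.< n →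
    ∣ + s * + 11 + - (+ 4 * + n) * + suc m ∣ ≤ K ℕ.* suc m →
    Σ[ y≢0 ∈ ℚ.NonZero (expected n) ] ℚ.∣ (x ℚ.÷ expected n) {{y≢0}} ℚ.- 1ℚ ∣ ℚ.< ε
  ratio-near-1 K s m n@(suc n-1) x ε@(mkℚ (+ suc p) d _) x≃ _ large deviation =
    ℚ.pos⇒nonZero (expected n) {{expected-positive n-1}} ,
    quotient-near-1 x (expected n) (expected-positive n-1)
      (ℚ.toℚᵘ-cancel-< (ℚᵘ.<-respˡ-≃ (ℚᵘ.≃-sym left) (ℚᵘ.<-respʳ-≃ (ℚᵘ.≃-sym right) near)))
    where
    yᵘ = mkℚᵘ (+ 4) 10 ℚᵘ.* mkℚᵘ (+ n) 0
    left : ℚ.toℚᵘ (ℚ.∣ x ℚ.- expected n ∣) ℚᵘ.≃ ℚᵘ.∣ mkℚᵘ (+ s) m ℚᵘ.+ ℚᵘ.- yᵘ ∣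
    left = ℚᵘ.≃-trans (ℚ.toℚᵘ-homo-∣-∣ (x ℚ.- expected n)) (ℚᵘ.∣-∣-cong
      (ℚᵘ.≃-trans (ℚ.toℚᵘ-homo-+ x (ℚ.- expected n)) (ℚᵘ.+-cong x≃
        (ℚᵘ.≃-trans (ℚ.toℚᵘ-homo‿- (expected n)) (ℚᵘ.-‿cong (expectedᵘ n))))))
    right : ℚ.toℚᵘ (ε ℚ.* expected n) ℚᵘ.≃ mkℚᵘ (+ suc p) d ℚᵘ.* yᵘ
    right = ℚᵘ.≃-trans (ℚ.toℚᵘ-homo-* ε (expected n)) (ℚᵘ.*-cong (ℚᵘ.≃-refl {mkℚᵘ (+ suc p) d}) (expectedᵘ n))
    bound : ∣ + s * + 11 + - (+ 4 * + n) * + suc m ∣ ℕ.* (suc d ℕ.* 11) ℕ.< suc p ℕ.* (4 ℕ.* n) ℕ.* (suc m ℕ.* 11)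
    bound = begin-strict
      ∣ + s * + 11 + - (+ 4 * + n) * + suc m ∣ ℕ.* (suc d ℕ.* 11)   ≤⟨ ℕ.*-monoˡ-≤ (suc d ℕ.* 11) deviation ⟩
      K ℕ.* suc m ℕ.* (suc d ℕ.* 11)          ≡⟨ rearrange K (suc m) (suc d) ⟩
      K ℕ.* suc d ℕ.* (suc m ℕ.* 11)          <⟨ ℕ.*-monoˡ-< (suc m ℕ.* 11) large ⟩
      n ℕ.* (suc m ℕ.* 11)                    ≤⟨ ℕ.*-monoˡ-≤ (suc m ℕ.* 11) (ℕ.≤-trans (ℕ.m≤m+n n _) (ℕ.m≤n*m (4 ℕ.* n) (suc p))) ⟩
      suc p ℕ.* (4 ℕ.* n) ℕ.* (suc m ℕ.* 11)  ∎
      where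
      open ℕ.≤-Reasoning
      rearrange : ∀ K m d → K ℕ.* m ℕ.* (d ℕ.* 11) ≡ K ℕ.* d ℕ.* (m ℕ.* 11)
      rearrange = ℕ-Ring.solve-∀
    near : ℚᵘ.∣ mkℚᵘ (+ s) m ℚᵘ.+ ℚᵘ.- yᵘ ∣ ℚᵘ.< mkℚᵘ (+ suc p) d ℚᵘ.* yᵘ
    near = *<* (subst₂ ℤ._<_
      (ℤ.pos-* ∣ + s * + 11 + - (+ 4 * + n) * + suc m ∣ (suc d ℕ.* 11))
      (trans (ℤ.pos-* (suc p ℕ.* (4 ℕ.* n)) (suc m ℕ.* 11))
             (cong (_* + (suc m ℕ.* 11)) (trans (ℤ.pos-* (suc p) (4 ℕ.* n)) (cong (+ suc p *_) (ℤ.pos-* 4 n)))))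
      (ℤ.+<+ bound))
  ratio-near-1 K s m zero        x ε x≃ _ () _
  ratio-near-1 K s m (suc _) x (mkℚ (+ 0) d _) x≃ (ℚ.*<* (ℤ.+<+ ())) _ _
  ratio-near-1 K s m (suc _) x (mkℚ (ℤ.-[1+ _ ]) d _) x≃ (ℚ.*<* ()) _ _

  meanᵘ : ∀ {A : Set} (xs : List A) f m → length xs ≡ suc m →
          ℚ.toℚᵘ (mean xs f) ℚᵘ.≃ mkℚᵘ (+ sum (map f xs)) m
  meanᵘ xs@(_ ∷ _) f _ refl = ℚ.toℚᵘ-fromℚᵘ (mkℚᵘ (+ sum (map f xs)) _)

  -- A witness that `trees n` is nonempty, so that the mean has a positive denominator.
  comb : ℕ → Tree
  comb zero    = leaf
  comb (suc n) = node leaf (comb n)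

  size-comb : ∀ n → size (comb n) ≡ n
  size-comb zero    = refl
  size-comb (suc n) = cong suc (size-comb n)

  count-positive : ∀ n → ∃[ m ] count n ≡ suc m
  count-positive n with count n | ∈.∈-length (subst (λ m → comb n ∈ trees m) (size-comb n) (∈-trees (comb n)))
  ... | suc m | _ = m , refl

  asymptotics : ∃[ K ] CompletionsBound K → (λ n → E[av [132] ] n (L U³D)) ∼ expected
  asymptotics (K , bound) ε 0<ε = suc (K′ ℕ.* ℚ.↧ₙ ε) , at
    where
    K′ = 48 ℕ.+ 2 ℕ.* K
    at : ∀ n → K′ ℕ.* ℚ.↧ₙ ε ℕ.< n → _
    -- Permutations and trees correspond only up to order; `ts` is the rearrangement of `trees n`
    -- that matches `S n [132]` entry by entry.
    at n large with count-positive n | ↭-map-inv (code 0) (↭-sym (S↭trees n))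
    ... | m , count≡ | ts , eq , ts↭ = ratio-near-1 K′ s m n (E[av [132] ] n (L U³D)) ε
        (meanᵘ (S n [132]) (L U³D) m (trans length≡ count≡)) 0<ε large
        (subst (λ k → ∣ + s * + 11 + - (+ 4 * + n) * + k ∣ ≤ K′ ℕ.* k) count≡
          (mean-deviation s (sum (map completions (trees n))) (count n) n K upper lower (bound n)))
      where
      s = sum (map (L U³D) (S n [132]))
      completions≡ : sum (map completions ts) ≡ sum (map completions (trees n))
      completions≡ = sum-↭ (↭.map⁺ completions (↭-sym ts↭))
      |ts| : length ts ≡ count n
      |ts| = ↭-length (↭-sym ts↭)
      length≡ : length (S n [132]) ≡ count n
      length≡ = trans (sym (List.length-map values (S n [132])))
        (trans (cong length eq) (trans (List.length-map (code 0) ts) |ts|))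
      upper : s ≤ count n ℕ.+ sum (map completions (trees n)) ℕ.* 4
      upper = subst (s ≤_) (cong₂ (λ a b → a ℕ.+ b ℕ.* 4) |ts| completions≡) (sum-L-upper (S n [132]) ts eq)
      lower : sum (map completions (trees n)) ℕ.* 4 ≤ s ℕ.+ count n ℕ.* 4
      lower = subst (λ (a , b) → a ℕ.* 4 ≤ s ℕ.+ b ℕ.* 4) (cong₂ _,_ completions≡ |ts|) (sum-L-lower (S n [132]) ts eq)

open Asymptotics using (asymptotics)

open import Data.Integer using (+_)
open import Data.Rational using (_/_; _*_)

theorem2 : (λ n → E[av [132] ] n (L U³D)) ∼ (λ n → (+ 4 / 11) * (+ n / 1))
theorem2 = asymptotics (negligible⇒bound completed-eleventh)
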